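{- For every integer $n\geq 16$, $\mathrm{ex}_{\mathcal{P}}(n,S_{2,2})=2n-4$.
   Context: All graphs are finite and simple. For a graph $F$, the planar Turán number $\mathrm{ex}_{\mathcal{P}}(n,F)$ is the maximum number of edges in an $n$-vertex planar graph that contains no subgraph isomorphic to $F$. For positive integers $m,k$, the double star $S_{m,k}$ is the tree obtained from an edge $xy$ (the backbone) by joining $x$ to $m$ new vertices and $y$ to $k$ further new vertices, all these $m+k$ vertices distinct; thus $S_{m,k}$ has $m+k+2$ vertices. -}

module Defs where

open import Data.Bool using (Bool; true; false)
import Data.Bool.Properties as Bool
open import Data.Fin using (Fin; zero; suc; toℕ; fromℕ; inject₁; _<_)
import Data.Fin.Properties as Fin
open import Data.Integer using (+_)
open import Data.List using (List; length; filter; allFin; cartesianProduct)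
open import Data.Nat as ℕ using (ℕ; zero; suc)
open import Data.Product using (Σ; ∃; _×_; _,_)
open import Data.Rational as ℚ using (ℚ; 0ℚ; 1ℚ; _/_)
open import Function.Definitions using (Injective)
open import Relation.Binary.PropositionalEquality using (_≡_; _≢_; refl)
open import Relation.Nullary using (¬_)
open import Relation.Nullary.Decidable using (_×-dec_)

record Graph (V : Set) : Set where
  field
    adj    : V → V → Bool
    sym    : ∀ u v → adj u v ≡ adj v u
    irrefl : ∀ v → adj v v ≡ false

  _~_ : V → V → Set
  u ~ v = adj u v ≡ true

-- Each edge {u , v} of a graph on Fin n is listed once, as the pair with u < v.
edges : ∀ {n} → Graph (Fin n) → List (Fin n × Fin n)
edges {n} G = filter (λ (u , v) → (u Fin.<? v) ×-dec (adj u v Bool.≟ true))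
                     (cartesianProduct (allFin n) (allFin n))
  where open Graph G

numEdges : ∀ {n} → Graph (Fin n) → ℕ
numEdges G = length (edges G)

-- A subgraph of G isomorphic to F is the image of an injective, adjacency
-- preserving map; it need not be induced.
record Copy {W V : Set} (F : Graph W) (G : Graph V) : Set where
  field
    embed     : W → V
    injective : Injective _≡_ _≡_ embed
    preserves : ∀ {u v} → Graph._~_ F u v → Graph._~_ G (embed u) (embed v)

Free : {W V : Set} → Graph W → Graph V → Set
Free F G = ¬ Copy F G

-- Planar graphs: vertices are distinct points of the plane, edges are simple
-- polygonal arcs, and the interior of an edge contains no vertex and no point
-- of another edge. The plane is ℚ²: a finite graph has such a drawing in ℝ²
-- (with polygonal or with arbitrary continuous arcs) iff it has one in ℚ².
-- Nothing is hidden at irrational points: two segments with rational ends that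
-- meet in ℝ² also meet in ℚ².

Point : Set
Point = ℚ × ℚ

lerp : ℚ → ℚ → ℚ → ℚ
lerp a b t = (1ℚ ℚ.- t) ℚ.* a ℚ.+ t ℚ.* b

onSegment : Point → Point → ℚ → Point
onSegment (a₁ , a₂) (b₁ , b₂) t = lerp a₁ b₁ t , lerp a₂ b₂ t

InUnit : ℚ → Set
InUnit t = (0ℚ ℚ.≤ t) × (t ℚ.≤ 1ℚ)

-- A polygonal arc is an injective map from [0 , segments] to the plane that is
-- affine on every [i , i + 1]. The parameter i + t is given as a piece i
-- together with t in [0 , 1], so an integer parameter i + 1 occurs both as the
-- end of piece i and as the start of piece i + 1; injectivity therefore
-- compares the values i + t.
parameter : ∀ {k} → Fin k → ℚ → ℚ
parameter i t = (+ toℕ i / 1) ℚ.+ t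

record Arc (a b : Point) : Set where
  field
    segments : ℕ
    corner   : Fin (suc segments) → Point
    source   : corner zero ≡ a
    target   : corner (fromℕ segments) ≡ b

  at : Fin segments → ℚ → Point
  at i t = onSegment (corner (inject₁ i)) (corner (suc i)) t

  field
    simple : ∀ i j s t → InUnit s → InUnit t →
             at i s ≡ at j t → parameter i s ≡ parameter j t

_on_ : ∀ {a b} → Point → Arc a b → Set
p on γ = ∃ λ i → ∃ λ t → InUnit t × Arc.at γ i t ≡ p

_inInteriorOf_ : ∀ {a b} → Point → Arc a b → Set
_inInteriorOf_ {a} {b} p γ = (p on γ) × p ≢ a × p ≢ b

record Edge {n} (G : Graph (Fin n)) : Set where
  field
    lo hi    : Fin n
    ordered  : lo < hi
    adjacent : Graph._~_ G lo hi

  ends : Fin n × Fin n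
  ends = lo , hi

open Edge using (lo; hi; ends)

record PlaneDrawing {n} (G : Graph (Fin n)) : Set where
  field
    pos          : Fin n → Point
    pos-distinct : Injective _≡_ _≡_ pos
    arc          : (e : Edge G) → Arc (pos (lo e)) (pos (hi e))
    no-vertex    : ∀ e w → ¬ (pos w inInteriorOf arc e)
    no-crossing  : ∀ e f → ends e ≢ ends f →
                   ∀ p → p inInteriorOf arc e → ¬ (p on arc f)

Planar : ∀ {n} → Graph (Fin n) → Set
Planar = PlaneDrawing

data StarVertex (m k : ℕ) : Set where
  x y   : StarVertex m k
  xleaf : Fin m → StarVertex m k
  yleaf : Fin k → StarVertex m k

doubleStar : (m k : ℕ) → Graph (StarVertex m k)
doubleStar m k = record { adj = adj ; sym = sym ; irrefl = irrefl }
  where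
  adj : StarVertex m k → StarVertex m k → Bool
  adj x         y         = true
  adj y         x         = true
  adj x         (xleaf _) = true
  adj (xleaf _) x         = true
  adj y         (yleaf _) = true
  adj (yleaf _) y         = true
  adj _         _         = false

  sym : ∀ u v → adj u v ≡ adj v u
  sym x x = refl
  sym x y = refl
  sym x (xleaf _) = refl
  sym x (yleaf _) = refl
  sym y x = refl
  sym y y = refl
  sym y (xleaf _) = refl
  sym y (yleaf _) = refl
  sym (xleaf _) x = refl
  sym (xleaf _) y = refl
  sym (xleaf _) (xleaf _) = refl
  sym (xleaf _) (yleaf _) = refl
  sym (yleaf _) x = refl
  sym (yleaf _) y = refl
  sym (yleaf _) (xleaf _) = refl
  sym (yleaf _) (yleaf _) = refl

  irrefl : ∀ v → adj v v ≡ false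
  irrefl x = refl
  irrefl y = refl
  irrefl (xleaf _) = refl
  irrefl (yleaf _) = refl

-- ex𝒫[ n , F ]≡ M says that M is the maximum number of edges: it is attained,
-- and it is an upper bound.
record ex𝒫[_,_]≡_ (n : ℕ) {W : Set} (F : Graph W) (M : ℕ) : Set where
  field
    attained : Σ (Graph (Fin n)) λ G → Planar G × Free F G × numEdges G ≡ M
    bound    : (G : Graph (Fin n)) → Planar G → Free F G → numEdges G ℕ.≤ M

{-# OPTIONS --safe #-}

-- Upper bound. An edge ab of an S₂,₂-free graph with deg a ≥ 5 has deg b ≤ 2, and one with
-- deg a ≥ 4, deg b ≥ 3 has N(b) ⊆ N[a]. If there is a vertex of degree at least 5, degrees
-- can be discharged along its edges so that their total is at most 4n - 8. Otherwise call a
-- vertex of degree at least 3 high, and full if all four of its neighbours are high. The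
-- closed neighbourhood of a full vertex spans a component of five vertices, so K₅ is the only
-- obstruction to discharging every vertex down to 18/5, which gives e ≤ 9n/5 < 2n - 3.
--
-- K₅ is not planar. For disjoint arcs α = ab and β = pq, count modulo 2 how often the upward
-- rays from p and q meet α and those from a and b meet β. The total is the number of pairs
-- (a or b, p or q) in which the latter is to the left: for two segments this is elementary,
-- and both sides telescope along polygonal arcs. Summed over the 15 pairs of disjoint edges
-- of K₅, every ray-arc term occurs twice, whereas the left-right terms have odd sum.

module Submission where

open import Defs
open import Data.Nat using (ℕ; _≤_; _*_; _∸_)
open import Algebra.Bundles using (CommutativeRing)
open import Data.Bool using (Bool; true; false; _∧_; _xor_; not)
import Data.Bool.Properties as Bool
open import Data.Bool.Properties
  using (xor-comm; xor-assoc; xor-same; xor-identityʳ; xor-∧-commutativeRing)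
open import Data.Empty using (⊥; ⊥-elim)
open import Data.Fin as Fin using (Fin; zero; suc; toℕ; fromℕ; inject₁)
open import Data.Fin.Patterns using (0F; 1F; 2F; 3F; 4F)
import Data.Fin.Properties as Fin
import Data.Integer as ℤ
import Data.Integer.Properties as ℤ
open import Data.List
  using (List; []; _∷_; _++_; length; filter; tabulate; cartesianProduct; map; foldr; concatMap)
import Data.List.Properties as List
open import Data.List.Relation.Unary.All as All using (All; []; _∷_; all?)
open import Data.Nat as ℕ using (zero; suc; _+_; _<_; z≤n; s≤s)
open import Data.Nat.Coprimality as Coprimality using (1-coprimeTo)
import Data.Nat.Properties as ℕ
open import Data.Nat.Tactic.RingSolver using (solve-∀)
open import Data.Product using (Σ; ∃; _×_; _,_; proj₁; proj₂)
open import Data.Product.Properties using () renaming (≡-dec to ×-≡-dec)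
open import Data.Product.Relation.Binary.Lex.Strict using (×-Lex; ×-decidable)
open import Data.Rational as ℚ using (ℚ; 0ℚ; 1ℚ; mkℚ; 1/_; ↥_)
import Data.Rational.Properties as ℚ
open import Data.Rational.Solver using (module +-*-Solver)
open import Data.Sum using (_⊎_; inj₁; inj₂)
open import Data.Sum.Properties using () renaming (≡-dec to ⊎-≡-dec)
open import Function using (_∘_; id)
open import Function.Definitions using (Injective)
open import Level using (0ℓ)
open import Relation.Binary.Definitions
  using (Decidable; DecidableEquality; tri<; tri≈; tri>)
open import Relation.Binary.PropositionalEquality
  using (_≡_; _≢_; refl; sym; trans; cong; cong₂; subst; subst₂; module ≡-Reasoning)
open import Relation.Nullary using (¬_; Dec; yes; no; does; contradiction)
open import Relation.Nullary.Decidable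
  using (⌊_⌋; isYes≗does; dec-true; dec-false; toWitness; _×-dec_; ¬?)
open import Relation.Unary using (Pred) renaming (Decidable to Decidable₁)

open import Algebra.Properties.CommutativeMonoid.Sum
  (CommutativeRing.+-commutativeMonoid xor-∧-commutativeRing)
  using () renaming (sum to ⨁; sum-cong-≗ to ⨁-cong; ∑-distrib-+ to ⨁-distrib; ∑-comm to ⨁-swap)
open import Algebra.Properties.Semiring.Sum ℕ.+-*-semiring
  using (sum; sum-cong-≗; ∑-distrib-+; ∑-comm; *-distribˡ-sum)
open +-*-Solver using (Polynomial; solve; con; _:+_; _:*_; _:-_; :-_; _:=_)

-- Intersecting segments

-- The constant 9/5 is the density of K₅ minus an edge. Its disjoint copies are planar and, having
-- only five vertices each, free of the six-vertex tree S₂,₂; three copies have 27 > 2·15 - 4 edges,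
-- so the formula fails at n = 15. Copies of K₅ itself would have density 2, hence planarity has to
-- exclude K₅. Call a high vertex that is not full half. A high vertex gives 4/5 to each low
-- neighbour, and a full one 1/5 to each half neighbour. These amounts are tight for a low vertex
-- with two high neighbours, and for both kinds of vertices of K₅ minus an edge: full ones with two
-- half neighbours, and half ones of degree 3 with three full neighbours. A hub, of degree at least
-- 5, gives one unit along each of its edges. It keeps nothing and so saves 4, while its neighbours,
-- of degree at most 2, end with at most 4. Two hubs save the required 8. A single hub saves 4, and
-- each of its at least five neighbours, receiving only once, ends with at most 3. The value 2n - 4
-- is attained by the complete bipartite graph with classes of sizes 2 and n - 2.

infixl 6 _⊕_ _⊖_
infixl 7 _·_

_⊕_ _⊖_ : Point → Point → Point
(a₁ , a₂) ⊕ (b₁ , b₂) = a₁ ℚ.+ b₁ , a₂ ℚ.+ b₂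
(a₁ , a₂) ⊖ (b₁ , b₂) = a₁ ℚ.- b₁ , a₂ ℚ.- b₂

_·_ : ℚ → Point → Point
s · (a₁ , a₂) = s ℚ.* a₁ , s ℚ.* a₂

infix 4 _≺_ _≺?_

-- The lexicographic order tilts the vertical rays infinitesimally: no ray from a point passes
-- through another point, and "left of" is a total order.
_≺_ : Point → Point → Set
_≺_ = ×-Lex _≡_ ℚ._<_ ℚ._<_

_≺?_ : Decidable _≺_
_≺?_ = ×-decidable ℚ._≟_ ℚ._<?_ ℚ._<?_

≺-trans : ∀ {p q r} → p ≺ q → q ≺ r → p ≺ r
≺-trans (inj₁ u) (inj₁ v) = inj₁ (ℚ.<-trans u v)
≺-trans (inj₁ u) (inj₂ (refl , _)) = inj₁ u
≺-trans (inj₂ (refl , _)) (inj₁ v) = inj₁ v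
≺-trans (inj₂ (refl , u)) (inj₂ (refl , v)) = inj₂ (refl , ℚ.<-trans u v)

≺-irrefl : ∀ {p} → ¬ p ≺ p
≺-irrefl (inj₁ u) = ℚ.<-irrefl refl u
≺-irrefl (inj₂ (_ , u)) = ℚ.<-irrefl refl u

≺-asym : ∀ {p q} → p ≺ q → ¬ q ≺ p
≺-asym u v = ≺-irrefl (≺-trans u v)

≺-cmp : ∀ p q → p ≺ q ⊎ p ≡ q ⊎ q ≺ p
≺-cmp (p₁ , p₂) (q₁ , q₂) with ℚ.<-cmp p₁ q₁ | ℚ.<-cmp p₂ q₂
... | tri< u _ _ | _ = inj₁ (inj₁ u)
... | tri> _ _ u | _ = inj₂ (inj₂ (inj₁ u))
... | tri≈ _ e _ | tri< u _ _ = inj₁ (inj₂ (e , u))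
... | tri≈ _ e _ | tri≈ _ f _ = inj₂ (inj₁ (cong₂ _,_ e f))
... | tri≈ _ e _ | tri> _ _ u = inj₂ (inj₂ (inj₂ (sym e , u)))

-- The positive cone of the lexicographic order. It is closed under sums and positive scaling, so
-- positions of points can be turned into signs of coefficients.
Positive : Point → Set
Positive v = (0ℚ , 0ℚ) ≺ v

p<q⇒0<q-p : ∀ {p q} → p ℚ.< q → 0ℚ ℚ.< q ℚ.- p
p<q⇒0<q-p {p} {q} u = subst (ℚ._< q ℚ.- p) (ℚ.+-inverseʳ p) (ℚ.+-monoˡ-< (ℚ.- p) u)

neg-pos : ∀ {p} → p ℚ.< 0ℚ → 0ℚ ℚ.< ℚ.- p
neg-pos = ℚ.neg-antimono-<

0<p*q : ∀ {p q} → 0ℚ ℚ.< p → 0ℚ ℚ.< q → 0ℚ ℚ.< p ℚ.* q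
0<p*q {p} {q} u v =
  ℚ.positive⁻¹ (p ℚ.* q) {{ℚ.pos*pos⇒pos p {{ℚ.positive u}} q {{ℚ.positive v}}}}

≺⇒positive : ∀ {p q} → p ≺ q → Positive (q ⊖ p)
≺⇒positive (inj₁ u) = inj₁ (p<q⇒0<q-p u)
≺⇒positive {p₁ , _} (inj₂ (refl , u)) = inj₂ (sym (ℚ.+-inverseʳ p₁) , p<q⇒0<q-p u)

positive-⊕ : ∀ {u v} → Positive u → Positive v → Positive (u ⊕ v)
positive-⊕ (inj₁ g) (inj₁ h) = inj₁ (ℚ.+-mono-< g h)
positive-⊕ {u₁ , _} (inj₁ g) (inj₂ (refl , _)) = inj₁ (subst (0ℚ ℚ.<_) (sym (ℚ.+-identityʳ u₁)) g)
positive-⊕ {v = v₁ , _} (inj₂ (refl , _)) (inj₁ h) = inj₁ (subst (0ℚ ℚ.<_) (sym (ℚ.+-identityˡ v₁)) h)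
positive-⊕ (inj₂ (refl , g)) (inj₂ (refl , h)) = inj₂ (refl , ℚ.+-mono-< g h)

positive-· : ∀ {s v} → 0ℚ ℚ.< s → Positive v → Positive (s · v)
positive-· z (inj₁ g) = inj₁ (0<p*q z g)
positive-· {s} z (inj₂ (refl , g)) = inj₂ (sym (ℚ.*-zeroʳ s) , 0<p*q z g)

positive-cancel : ∀ {s v} → Positive v → Positive (s · v) → 0ℚ ℚ.< s
positive-cancel {s} {v₁ , v₂} g h with ℚ.<-cmp 0ℚ s
... | tri< z _ _ = z
... | tri≈ _ refl _ = contradiction
  (subst Positive (cong₂ _,_ (ℚ.*-zeroˡ v₁) (ℚ.*-zeroˡ v₂)) h) ≺-irrefl
... | tri> _ _ z = contradiction
  (subst Positive (cong₂ _,_ (annihilate s v₁) (annihilate s v₂))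
    (positive-⊕ h (positive-· (neg-pos z) g))) ≺-irrefl
  where
  annihilate : ∀ s v → s ℚ.* v ℚ.+ (ℚ.- s) ℚ.* v ≡ 0ℚ
  annihilate = solve 2 (λ s v → s :* v :+ (:- s) :* v := con 0ℚ) refl

-- Degenerate segments are allowed: `Disjoint a b p p` says that `p` is off the segment `ab`.
Disjoint : (a b p q : Point) → Set
Disjoint a b p q = ∀ s t → InUnit s → InUnit t → onSegment a b s ≢ onSegment p q t

-- The lines ab and pq have the common point (β p + α q) / (α + β) = (δ a + γ b) / (γ + δ).
record Balance (a b p q : Point) (α β γ δ : ℚ) : Set where
  constructor balance
  field
    total : α ℚ.+ β ≡ γ ℚ.+ δ
    point : β · p ⊕ α · q ≡ δ · a ⊕ γ · b

module _ {a b p q α β γ δ} (B : Balance a b p q α β γ δ) where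
  open Balance B

  private
    from-a : ∀ {a b p q} → β ℚ.* p ℚ.+ α ℚ.* q ≡ δ ℚ.* a ℚ.+ γ ℚ.* b →
             β ℚ.* (p ℚ.- a) ℚ.+ α ℚ.* (q ℚ.- a) ≡ γ ℚ.* (b ℚ.- a)
    from-a {a} {b} {p} {q} e = begin
      β ℚ.* (p ℚ.- a) ℚ.+ α ℚ.* (q ℚ.- a)
        ≡⟨ solve 5 (λ α β a p q → β :* (p :- a) :+ α :* (q :- a) :=
                                  (β :* p :+ α :* q) :- (α :+ β) :* a) refl α β a p q ⟩
      (β ℚ.* p ℚ.+ α ℚ.* q) ℚ.- (α ℚ.+ β) ℚ.* a
        ≡⟨ cong₂ (λ g h → g ℚ.- h ℚ.* a) e total ⟩
      (δ ℚ.* a ℚ.+ γ ℚ.* b) ℚ.- (γ ℚ.+ δ) ℚ.* a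
        ≡⟨ solve 4 (λ γ δ a b → (δ :* a :+ γ :* b) :- (γ :+ δ) :* a := γ :* (b :- a)) refl γ δ a b ⟩
      γ ℚ.* (b ℚ.- a) ∎
      where open ≡-Reasoning

  -- Subtract `α + β = γ + δ` times `a` from `point`. If the left side is a positive vector and
  -- `a ≺ b`, then `positive-cancel` gives the sign of `γ`; the two variants below yield `β` and `δ`
  -- in the same way.
  seen-from-a : β · (p ⊖ a) ⊕ α · (q ⊖ a) ≡ γ · (b ⊖ a)
  seen-from-a = cong₂ _,_ (from-a (cong proj₁ point)) (from-a (cong proj₂ point))

  private
    from-b : ∀ {a b p q} → β ℚ.* p ℚ.+ α ℚ.* q ≡ δ ℚ.* a ℚ.+ γ ℚ.* b →
             δ ℚ.* (b ℚ.- a) ℚ.+ α ℚ.* (q ℚ.- b) ≡ β ℚ.* (b ℚ.- p)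
    from-b {a} {b} {p} {q} e = begin
      δ ℚ.* (b ℚ.- a) ℚ.+ α ℚ.* (q ℚ.- b)
        ≡⟨ solve 6 (λ α γ δ a b q → δ :* (b :- a) :+ α :* (q :- b) :=
             (γ :+ δ :- α) :* b :- ((δ :* a :+ γ :* b) :- α :* q)) refl α γ δ a b q ⟩
      (γ ℚ.+ δ ℚ.- α) ℚ.* b ℚ.- ((δ ℚ.* a ℚ.+ γ ℚ.* b) ℚ.- α ℚ.* q)
        ≡⟨ cong₂ (λ g h → (g ℚ.- α) ℚ.* b ℚ.- (h ℚ.- α ℚ.* q)) (sym total) (sym e) ⟩
      (α ℚ.+ β ℚ.- α) ℚ.* b ℚ.- ((β ℚ.* p ℚ.+ α ℚ.* q) ℚ.- α ℚ.* q)
        ≡⟨ solve 5 (λ α β b p q → (α :+ β :- α) :* b :- ((β :* p :+ α :* q) :- α :* q) :=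
                                  β :* (b :- p)) refl α β b p q ⟩
      β ℚ.* (b ℚ.- p) ∎
      where open ≡-Reasoning

  seen-from-b : δ · (b ⊖ a) ⊕ α · (q ⊖ b) ≡ β · (b ⊖ p)
  seen-from-b = cong₂ _,_ (from-b (cong proj₁ point)) (from-b (cong proj₂ point))

  private
    from-b′ : ∀ {a b p q} → β ℚ.* p ℚ.+ α ℚ.* q ≡ δ ℚ.* a ℚ.+ γ ℚ.* b →
              β ℚ.* (b ℚ.- p) ℚ.+ α ℚ.* (b ℚ.- q) ≡ δ ℚ.* (b ℚ.- a)
    from-b′ {a} {b} {p} {q} e = begin
      β ℚ.* (b ℚ.- p) ℚ.+ α ℚ.* (b ℚ.- q)
        ≡⟨ solve 5 (λ α β b p q → β :* (b :- p) :+ α :* (b :- q) :=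
                                  (α :+ β) :* b :- (β :* p :+ α :* q)) refl α β b p q ⟩
      (α ℚ.+ β) ℚ.* b ℚ.- (β ℚ.* p ℚ.+ α ℚ.* q)
        ≡⟨ cong₂ (λ s u → s ℚ.* b ℚ.- u) total e ⟩
      (γ ℚ.+ δ) ℚ.* b ℚ.- (δ ℚ.* a ℚ.+ γ ℚ.* b)
        ≡⟨ solve 4 (λ γ δ a b → (γ :+ δ) :* b :- (δ :* a :+ γ :* b) := δ :* (b :- a)) refl γ δ a b ⟩
      δ ℚ.* (b ℚ.- a) ∎
      where open ≡-Reasoning

  seen-from-b′ : β · (b ⊖ p) ⊕ α · (b ⊖ q) ≡ δ · (b ⊖ a)
  seen-from-b′ = cong₂ _,_ (from-b′ (cong proj₁ point)) (from-b′ (cong proj₂ point))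

  -- The weights are homogeneous, so a configuration with all sides exchanged reduces to the
  -- original one.
  negate : Balance a b p q (ℚ.- α) (ℚ.- β) (ℚ.- γ) (ℚ.- δ)
  negate = balance
    (trans (sym (ℚ.neg-distrib-+ α β)) (trans (cong ℚ.-_ total) (ℚ.neg-distrib-+ γ δ)))
    (cong₂ _,_ (flip (cong proj₁ point)) (flip (cong proj₂ point)))
    where
    negate-out : ∀ β p α q → (ℚ.- β) ℚ.* p ℚ.+ (ℚ.- α) ℚ.* q ≡ ℚ.- (β ℚ.* p ℚ.+ α ℚ.* q)
    negate-out = solve 4 (λ β p α q → (:- β) :* p :+ (:- α) :* q := :- (β :* p :+ α :* q)) refl
    flip : ∀ {a b p q} → β ℚ.* p ℚ.+ α ℚ.* q ≡ δ ℚ.* a ℚ.+ γ ℚ.* b →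
           (ℚ.- β) ℚ.* p ℚ.+ (ℚ.- α) ℚ.* q ≡ (ℚ.- δ) ℚ.* a ℚ.+ (ℚ.- γ) ℚ.* b
    flip {a} {b} {p} {q} e =
      trans (negate-out β p α q) (trans (cong ℚ.-_ e) (sym (negate-out δ a γ b)))

  -- Division by the positive total turns the weights into parameters in the unit interval:
  -- `γ / (γ + δ)` on `ab` and `α / (α + β)` on `pq`.
  meet : 0ℚ ℚ.≤ α → 0ℚ ℚ.< β → 0ℚ ℚ.≤ γ → 0ℚ ℚ.≤ δ → ¬ Disjoint a b p q
  meet 0≤α 0<β 0≤γ 0≤δ disjoint =
    disjoint (γ ℚ.* r) (α ℚ.* r)
      (unit γ δ (trans (cong (ℚ._* r) (sym total)) sr) 0≤γ 0≤δ)
      (unit α β sr 0≤α (ℚ.<⇒≤ 0<β))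
      (cong₂ _,_ (lerp-eq (cong proj₁ point)) (lerp-eq (cong proj₂ point)))
    where
    s = α ℚ.+ β
    0<s : 0ℚ ℚ.< s
    0<s = ℚ.+-mono-≤-< 0≤α 0<β
    instance
      s-pos : ℚ.Positive s
      s-pos = ℚ.positive 0<s
      s-nonZero : ℚ.NonZero s
      s-nonZero = ℚ.pos⇒nonZero s
    r = 1/ s
    sr : s ℚ.* r ≡ 1ℚ
    sr = ℚ.*-inverseʳ s
    instance
      r-nonNeg : ℚ.NonNegative r
      r-nonNeg = ℚ.pos⇒nonNeg r {{ℚ.1/pos⇒pos s}}
    unit : ∀ g h → (g ℚ.+ h) ℚ.* r ≡ 1ℚ → 0ℚ ℚ.≤ g → 0ℚ ℚ.≤ h → InUnit (g ℚ.* r)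
    unit g h e u v =
      subst (ℚ._≤ g ℚ.* r) (ℚ.*-zeroˡ r) (ℚ.*-monoʳ-≤-nonNeg r u) ,
      subst (g ℚ.* r ℚ.≤_) e
        (ℚ.*-monoʳ-≤-nonNeg r (subst (ℚ._≤ g ℚ.+ h) (ℚ.+-identityʳ g) (ℚ.+-monoʳ-≤ g v)))
    lerp-eq : ∀ {a b p q} → β ℚ.* p ℚ.+ α ℚ.* q ≡ δ ℚ.* a ℚ.+ γ ℚ.* b →
              lerp a b (γ ℚ.* r) ≡ lerp p q (α ℚ.* r)
    lerp-eq {a} {b} {p} {q} e = begin
      (1ℚ ℚ.- γ ℚ.* r) ℚ.* a ℚ.+ γ ℚ.* r ℚ.* b
        ≡⟨ cong (λ g → (g ℚ.- γ ℚ.* r) ℚ.* a ℚ.+ γ ℚ.* r ℚ.* b)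
             (trans (sym sr) (cong (ℚ._* r) total)) ⟩
      ((γ ℚ.+ δ) ℚ.* r ℚ.- γ ℚ.* r) ℚ.* a ℚ.+ γ ℚ.* r ℚ.* b
        ≡⟨ solve 5 (λ γ δ r a b → ((γ :+ δ) :* r :- γ :* r) :* a :+ γ :* r :* b :=
                                  (δ :* a :+ γ :* b) :* r) refl γ δ r a b ⟩
      (δ ℚ.* a ℚ.+ γ ℚ.* b) ℚ.* r
        ≡⟨ cong (ℚ._* r) (sym e) ⟩
      (β ℚ.* p ℚ.+ α ℚ.* q) ℚ.* r
        ≡⟨ solve 5 (λ α β r p q → (β :* p :+ α :* q) :* r :=
                     ((α :+ β) :* r :- α :* r) :* p :+ α :* r :* q) refl α β r p q ⟩
      (s ℚ.* r ℚ.- α ℚ.* r) ℚ.* p ℚ.+ α ℚ.* r ℚ.* q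
        ≡⟨ cong (λ g → (g ℚ.- α ℚ.* r) ℚ.* p ℚ.+ α ℚ.* r ℚ.* q) sr ⟩
      (1ℚ ℚ.- α ℚ.* r) ℚ.* p ℚ.+ α ℚ.* r ℚ.* q ∎
      where open ≡-Reasoning

-- Twice the signed area of the triangle `abp`. For `a` to the left of `b` it is negative when `p`
-- is below the line `ab`.
orient : Point → Point → Point → ℚ
orient (a₁ , a₂) (b₁ , b₂) (p₁ , p₂) =
  (b₁ ℚ.- a₁) ℚ.* (p₂ ℚ.- a₂) ℚ.- (b₂ ℚ.- a₂) ℚ.* (p₁ ℚ.- a₁)

-- Cramer's rule: the ends of each segment are weighted by their signed distances from the line of
-- the other. The identities are polynomial and hold for parallel lines too, where the total is
-- zero.
orient-balance : ∀ a b p q → Balance a b p q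
  (ℚ.- orient a b p) (orient a b q) (orient p q a) (ℚ.- orient p q b)
orient-balance (a₁ , a₂) (b₁ , b₂) (p₁ , p₂) (q₁ , q₂) = balance
  (solve 8 (λ a₁ a₂ b₁ b₂ p₁ p₂ q₁ q₂ →
     :- or a₁ a₂ b₁ b₂ p₁ p₂ :+ or a₁ a₂ b₁ b₂ q₁ q₂ :=
     or p₁ p₂ q₁ q₂ a₁ a₂ :+ :- or p₁ p₂ q₁ q₂ b₁ b₂) refl a₁ a₂ b₁ b₂ p₁ p₂ q₁ q₂)
  (cong₂ _,_
    (solve 8 (λ a₁ a₂ b₁ b₂ p₁ p₂ q₁ q₂ →
       or a₁ a₂ b₁ b₂ q₁ q₂ :* p₁ :+ (:- or a₁ a₂ b₁ b₂ p₁ p₂) :* q₁ :=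
       (:- or p₁ p₂ q₁ q₂ b₁ b₂) :* a₁ :+ or p₁ p₂ q₁ q₂ a₁ a₂ :* b₁)
     refl a₁ a₂ b₁ b₂ p₁ p₂ q₁ q₂)
    (solve 8 (λ a₁ a₂ b₁ b₂ p₁ p₂ q₁ q₂ →
       or a₁ a₂ b₁ b₂ q₁ q₂ :* p₂ :+ (:- or a₁ a₂ b₁ b₂ p₁ p₂) :* q₂ :=
       (:- or p₁ p₂ q₁ q₂ b₁ b₂) :* a₂ :+ or p₁ p₂ q₁ q₂ a₁ a₂ :* b₂)
     refl a₁ a₂ b₁ b₂ p₁ p₂ q₁ q₂))
  where
  or : ∀ {n} → (a₁ a₂ b₁ b₂ p₁ p₂ : Polynomial n) → Polynomial n
  or a₁ a₂ b₁ b₂ p₁ p₂ = (b₁ :- a₁) :* (p₂ :- a₂) :- (b₂ :- a₂) :* (p₁ :- a₁)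

+0-drop : ∀ {u v o} → u ≡ v ℚ.+ o → o ≡ 0ℚ → u ≡ v
+0-drop {v = v} e refl = trans e (ℚ.+-identityʳ v)

-- For `q = p` on the line `ab` all weights of `orient-balance` vanish. Differences of one
-- coordinate replace them, namely of the one in which `a ≺ b` is decided, so that `β` is positive.
onLine-balance : ∀ a b p → a ≺ b → orient a b p ≡ 0ℚ →
  Σ ℚ λ β → Σ ℚ λ γ → Σ ℚ λ δ → 0ℚ ℚ.< β × (∀ q → Balance a b p q 0ℚ β γ δ)
onLine-balance (a₁ , a₂) (b₁ , b₂) (p₁ , p₂) (inj₁ a₁<b₁) collinear =
  b₁ ℚ.- a₁ , p₁ ℚ.- a₁ , b₁ ℚ.- p₁ , p<q⇒0<q-p a₁<b₁ , λ (q₁ , q₂) → balance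
    (solve 3 (λ a b p → con 0ℚ :+ (b :- a) := (p :- a) :+ (b :- p)) refl a₁ b₁ p₁)
    (cong₂ _,_
      (solve 4 (λ a b p q → (b :- a) :* p :+ con 0ℚ :* q := (b :- p) :* a :+ (p :- a) :* b)
        refl a₁ b₁ p₁ q₁)
      (+0-drop
        (solve 7 (λ a₁ a₂ b₁ b₂ p₁ p₂ q₂ → (b₁ :- a₁) :* p₂ :+ con 0ℚ :* q₂ :=
          ((b₁ :- p₁) :* a₂ :+ (p₁ :- a₁) :* b₂) :+
          ((b₁ :- a₁) :* (p₂ :- a₂) :- (b₂ :- a₂) :* (p₁ :- a₁)))
          refl a₁ a₂ b₁ b₂ p₁ p₂ q₂)
        collinear))
onLine-balance (a₁ , a₂) (b₁ , b₂) (p₁ , p₂) (inj₂ (_ , a₂<b₂)) collinear =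
  b₂ ℚ.- a₂ , p₂ ℚ.- a₂ , b₂ ℚ.- p₂ , p<q⇒0<q-p a₂<b₂ , λ (q₁ , q₂) → balance
    (solve 3 (λ a b p → con 0ℚ :+ (b :- a) := (p :- a) :+ (b :- p)) refl a₂ b₂ p₂)
    (cong₂ _,_
      (+0-drop
        (solve 7 (λ a₁ a₂ b₁ b₂ p₁ p₂ q₁ → (b₂ :- a₂) :* p₁ :+ con 0ℚ :* q₁ :=
          ((b₂ :- p₂) :* a₁ :+ (p₂ :- a₂) :* b₁) :-
          ((b₁ :- a₁) :* (p₂ :- a₂) :- (b₂ :- a₂) :* (p₁ :- a₁)))
          refl a₁ a₂ b₁ b₂ p₁ p₂ q₁)
        (cong ℚ.-_ collinear))
      (solve 4 (λ a b p q → (b :- a) :* p :+ con 0ℚ :* q := (b :- p) :* a :+ (p :- a) :* b)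
        refl a₂ b₂ p₂ q₂))

lerp-start : ∀ a b → lerp a b 0ℚ ≡ a
lerp-start = solve 2 (λ a b → (con 1ℚ :- con 0ℚ) :* a :+ con 0ℚ :* b := a) refl

lerp-const : ∀ a t → lerp a a t ≡ a
lerp-const = solve 2 (λ a t → (con 1ℚ :- t) :* a :+ t :* a := a) refl

lerp-flip : ∀ a b t → lerp b a (1ℚ ℚ.- t) ≡ lerp a b t
lerp-flip = solve 3 (λ a b t →
  (con 1ℚ :- (con 1ℚ :- t)) :* b :+ (con 1ℚ :- t) :* a := (con 1ℚ :- t) :* a :+ t :* b) refl

unit-flip : ∀ {t} → InUnit t → InUnit (1ℚ ℚ.- t)
unit-flip {t} (u , v) =
  subst (ℚ._≤ 1ℚ ℚ.- t) (ℚ.+-inverseʳ t) (ℚ.+-monoˡ-≤ (ℚ.- t) v) ,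
  ℚ.+-monoʳ-≤ 1ℚ (ℚ.neg-antimono-≤ u)

0≤1 : 0ℚ ℚ.≤ 1ℚ
0≤1 = ℚ.nonNegative⁻¹ 1ℚ

disjoint-sym : ∀ {a b p q} → Disjoint a b p q → Disjoint p q a b
disjoint-sym d s t u v e = d t s v u (sym e)

disjoint-flip : ∀ {a b p q} → Disjoint a b p q → Disjoint a b q p
disjoint-flip {p = p₁ , p₂} {q₁ , q₂} d s t u v e =
  d s (1ℚ ℚ.- t) u (unit-flip v)
    (trans e (sym (cong₂ _,_ (lerp-flip q₁ p₁ t) (lerp-flip q₂ p₂ t))))

disjoint-end : ∀ {a b p q} → Disjoint a b p q → Disjoint a b p p
disjoint-end {p = p₁ , p₂} {q₁ , q₂} d s t u _ e = d s 0ℚ u (ℚ.≤-refl , 0≤1)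
  (trans e (cong₂ _,_ (trans (lerp-const p₁ t) (sym (lerp-start p₁ q₁)))
                      (trans (lerp-const p₂ t) (sym (lerp-start p₂ q₂)))))

module _ {a b p q α β γ δ} (B : Balance a b p q α β γ δ) where

  nested-meet : 0ℚ ℚ.< α → 0ℚ ℚ.< β → a ≺ p → a ≺ q → p ≺ b → q ≺ b → ¬ Disjoint a b p q
  nested-meet 0<α 0<β a≺p a≺q p≺b q≺b =
    meet B (ℚ.<⇒≤ 0<α) 0<β
      (ℚ.<⇒≤ (positive-cancel b-a (subst Positive (seen-from-a B)
        (positive-⊕ (positive-· 0<β (≺⇒positive a≺p)) (positive-· 0<α (≺⇒positive a≺q))))))
      (ℚ.<⇒≤ (positive-cancel b-a (subst Positive (seen-from-b′ B)
        (positive-⊕ (positive-· 0<β (≺⇒positive p≺b)) (positive-· 0<α (≺⇒positive q≺b))))))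
    where
    b-a : Positive (b ⊖ a)
    b-a = ≺⇒positive (≺-trans a≺p p≺b)

  interleaved-meet : 0ℚ ℚ.< α → 0ℚ ℚ.< δ → a ≺ p → p ≺ b → b ≺ q → ¬ Disjoint a b p q
  interleaved-meet 0<α 0<δ a≺p p≺b b≺q =
    meet B (ℚ.<⇒≤ 0<α) 0<β
      (ℚ.<⇒≤ (positive-cancel b-a (subst Positive (seen-from-a B)
        (positive-⊕ (positive-· 0<β (≺⇒positive a≺p))
                    (positive-· 0<α (≺⇒positive (≺-trans (≺-trans a≺p p≺b) b≺q)))))))
      (ℚ.<⇒≤ 0<δ)
    where
    b-a : Positive (b ⊖ a)
    b-a = ≺⇒positive (≺-trans a≺p p≺b)
    0<β : 0ℚ ℚ.< β
    0<β = positive-cancel (≺⇒positive p≺b) (subst Positive (seen-from-b B)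
      (positive-⊕ (positive-· 0<δ b-a) (positive-· 0<α (≺⇒positive b≺q))))

onLine-meet : ∀ {a b p} → a ≺ p → p ≺ b → orient a b p ≡ 0ℚ → ¬ Disjoint a b p p
onLine-meet {a} {b} {p} a≺p p≺b collinear
  with onLine-balance a b p (≺-trans a≺p p≺b) collinear
... | β , γ , δ , 0<β , B =
  meet (B p) ℚ.≤-refl 0<β
    (ℚ.<⇒≤ (positive-cancel b-a (subst Positive (trans (sym (drop a p)) (seen-from-a (B p)))
      (positive-· 0<β (≺⇒positive a≺p)))))
    (ℚ.<⇒≤ (positive-cancel b-a (subst Positive (trans (sym (drop p b)) (seen-from-b′ (B p)))
      (positive-· 0<β (≺⇒positive p≺b)))))
  where
  b-a : Positive (b ⊖ a)
  b-a = ≺⇒positive (≺-trans a≺p p≺b)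
  drop₁ : ∀ β u v → β ℚ.* (v ℚ.- u) ℚ.+ 0ℚ ℚ.* (v ℚ.- u) ≡ β ℚ.* (v ℚ.- u)
  drop₁ = solve 3 (λ β u v → β :* (v :- u) :+ con 0ℚ :* (v :- u) := β :* (v :- u)) refl
  drop : ∀ u v → β · (v ⊖ u) ⊕ 0ℚ · (v ⊖ u) ≡ β · (v ⊖ u)
  drop (u₁ , u₂) (v₁ , v₂) = cong₂ _,_ (drop₁ β u₁ v₁) (drop₁ β u₂ v₂)

-- Crossing parity of two disjoint segments

abstract
  before : Point → Point → Bool
  before p q = ⌊ p ≺? q ⌋

  before-true : ∀ {p q} → p ≺ q → before p q ≡ true
  before-true {p} {q} u = trans (isYes≗does (p ≺? q)) (dec-true (p ≺? q) u)

  before-false : ∀ {p q} → p ≺ q → before q p ≡ false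
  before-false {p} {q} u = trans (isYes≗does (q ≺? p)) (dec-false (q ≺? p) (≺-asym u))

  negative : ℚ → Bool
  negative r = ⌊ r ℚ.<? 0ℚ ⌋

  negative-true : ∀ {r} → r ℚ.< 0ℚ → negative r ≡ true
  negative-true {r} u = trans (isYes≗does (r ℚ.<? 0ℚ)) (dec-true (r ℚ.<? 0ℚ) u)

  negative-false : ∀ {r} → 0ℚ ℚ.< r → negative r ≡ false
  negative-false {r} u = trans (isYes≗does (r ℚ.<? 0ℚ)) (dec-false (r ℚ.<? 0ℚ) (ℚ.<-asym u))

before-not : ∀ {p q} → p ≢ q → before q p ≡ not (before p q)
before-not {p} {q} p≢q with ≺-cmp p q
... | inj₁ u = trans (before-false u) (sym (cong not (before-true u)))
... | inj₂ (inj₁ e) = contradiction e p≢q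
... | inj₂ (inj₂ u) = trans (before-true u) (sym (cong not (before-false u)))

data Sign (r : ℚ) : Set where
  minus : r ℚ.< 0ℚ → Sign r
  plus  : 0ℚ ℚ.< r → Sign r

sign : ∀ r → r ≢ 0ℚ → Sign r
sign r r≢0 with ℚ.<-cmp r 0ℚ
... | tri< u _ _ = minus u
... | tri≈ _ e _ = contradiction e r≢0
... | tri> _ _ u = plus u

module _ {a b p q : Point} (d : Disjoint a b p q) where

  private
    B : Balance a b p q (ℚ.- orient a b p) (orient a b q) (orient p q a) (ℚ.- orient p q b)
    B = orient-balance a b p q

    neg-neg-pos : ∀ {r} → 0ℚ ℚ.< r → 0ℚ ℚ.< ℚ.- (ℚ.- r)
    neg-neg-pos u = ℚ.neg-antimono-< (ℚ.neg-antimono-< u)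

  off-line : a ≺ p → p ≺ b → Sign (orient a b p)
  off-line a≺p p≺b =
    sign _ λ collinear → onLine-meet a≺p p≺b collinear (disjoint-end d)

  -- If `p` and `q` were on opposite sides of the line `ab`, then `pq` would meet that line in a
  -- point which, like `p` and `q`, is between `a` and `b`.
  nested-same-side : a ≺ p → a ≺ q → p ≺ b → q ≺ b → Sign (orient a b p) → Sign (orient a b q) →
                     negative (orient a b p) ≡ negative (orient a b q)
  nested-same-side _ _ _ _ (minus u) (minus v) = trans (negative-true u) (sym (negative-true v))
  nested-same-side _ _ _ _ (plus u) (plus v) = trans (negative-false u) (sym (negative-false v))
  nested-same-side a≺p a≺q p≺b q≺b (minus u) (plus v) =
    contradiction d (nested-meet B (neg-pos u) v a≺p a≺q p≺b q≺b)
  nested-same-side a≺p a≺q p≺b q≺b (plus u) (minus v) =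
    contradiction d (nested-meet (negate B) (neg-neg-pos u) (neg-pos v) a≺p a≺q p≺b q≺b)

  -- On the overlap from `p` to `b` one segment stays above the other. If it is `ab`, then `p` is
  -- below `ab` and `b` is above `pq`; equal signs mean that the segments change places and hence
  -- meet.
  interleaved-opposite : a ≺ p → p ≺ b → b ≺ q → Sign (orient a b p) → Sign (orient p q b) →
                         negative (orient a b p) xor negative (orient p q b) ≡ true
  interleaved-opposite _ _ _ (minus u) (plus v) = cong₂ _xor_ (negative-true u) (negative-false v)
  interleaved-opposite _ _ _ (plus u) (minus v) = cong₂ _xor_ (negative-false u) (negative-true v)
  interleaved-opposite a≺p p≺b b≺q (minus u) (minus v) =
    contradiction d (interleaved-meet B (neg-pos u) (neg-pos v) a≺p p≺b b≺q)
  interleaved-opposite a≺p p≺b b≺q (plus u) (plus v) =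
    contradiction d (interleaved-meet (negate B) (neg-neg-pos u) (neg-neg-pos v) a≺p p≺b b≺q)

-- The upward ray from `p` meets the segment `ab`, for `a` to the left of `b`. At most one of
-- `under p a b` and `under p b a` holds, so the `xor` in `crosses` is a disjunction.
under : (p a b : Point) → Bool
under p a b = before a p ∧ (before p b ∧ negative (orient a b p))

crosses : (p a b : Point) → Bool
crosses p a b = under p a b xor under p b a

crosses-between : ∀ {p a b} → a ≺ p → p ≺ b → crosses p a b ≡ negative (orient a b p)
crosses-between {p} {a} {b} a≺p p≺b = trans
  (cong₂ _xor_
    (cong₂ _∧_ (before-true a≺p) (cong (_∧ negative (orient a b p)) (before-true p≺b)))
    (cong (_∧ (before p a ∧ negative (orient b a p))) (before-false p≺b)))
  (xor-identityʳ _)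

crosses-left : ∀ {p a b} → p ≺ a → p ≺ b → crosses p a b ≡ false
crosses-left {p} {a} {b} p≺a p≺b = cong₂ _xor_
  (cong (_∧ (before p b ∧ negative (orient a b p))) (before-false p≺a))
  (cong (_∧ (before p a ∧ negative (orient b a p))) (before-false p≺b))

crosses-right : ∀ {p a b} → a ≺ p → b ≺ p → crosses p a b ≡ false
crosses-right {p} {a} {b} a≺p b≺p = cong₂ _xor_
  (cong₂ _∧_ (before-true a≺p) (cong (_∧ negative (orient a b p)) (before-false b≺p)))
  (cong₂ _∧_ (before-true b≺p) (cong (_∧ negative (orient b a p)) (before-false a≺p)))

Parity : (a b p q : Point) → Set
Parity a b p q =
  (crosses p a b xor crosses q a b) xor (crosses a p q xor crosses b p q) ≡
  (before p a xor before q a) xor (before p b xor before q b)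

xor₄ : ∀ {s t u v s′ t′ u′ v′} → s ≡ s′ → t ≡ t′ → u ≡ u′ → v ≡ v′ →
       (s xor t) xor (u xor v) ≡ (s′ xor t′) xor (u′ xor v′)
xor₄ e f g h = cong₂ _xor_ (cong₂ _xor_ e f) (cong₂ _xor_ g h)

-- Three orders are possible. For `a b p q` all terms vanish. For `a p b q` only `before p b` holds
-- on the right, and exactly one of the two relevant rays hits. For `a p q b` both sides consist of
-- two equal terms.
parity-ordered : ∀ {a b p q} → Disjoint a b p q → a ≺ b → p ≺ q → a ≺ p → p ≢ b → q ≢ b → Parity a b p q
parity-ordered {a} {b} {p} {q} d a≺b p≺q a≺p p≢b q≢b with ≺-cmp b p
... | inj₂ (inj₁ e) = contradiction (sym e) p≢b
... | inj₁ b≺p = trans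
  (xor₄ (crosses-right a≺p b≺p) (crosses-right (≺-trans a≺p p≺q) (≺-trans b≺p p≺q))
        (crosses-left a≺p (≺-trans a≺p p≺q)) (crosses-left b≺p (≺-trans b≺p p≺q)))
  (sym (xor₄ (before-false a≺p) (before-false (≺-trans a≺p p≺q))
             (before-false b≺p) (before-false (≺-trans b≺p p≺q))))
... | inj₂ (inj₂ p≺b) with ≺-cmp b q
...   | inj₂ (inj₁ e) = contradiction (sym e) q≢b
...   | inj₁ b≺q = trans
  (xor₄ (crosses-between a≺p p≺b) (crosses-right (≺-trans a≺p p≺q) b≺q)
        (crosses-left a≺p (≺-trans a≺p p≺q)) (crosses-between p≺b b≺q))
  (trans
    (trans (cong (_xor negative (orient p q b)) (xor-identityʳ (negative (orient a b p))))
      (interleaved-opposite d a≺p p≺b b≺q (off-line d a≺p p≺b)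
        (off-line (disjoint-flip (disjoint-sym d)) p≺b b≺q)))
    (sym (xor₄ (before-false a≺p) (before-false (≺-trans a≺p p≺q))
               (before-true p≺b) (before-false b≺q))))
...   | inj₂ (inj₂ q≺b) = trans
  (xor₄ (crosses-between a≺p p≺b) (crosses-between (≺-trans a≺p p≺q) q≺b)
        (crosses-left a≺p (≺-trans a≺p p≺q)) (crosses-right p≺b q≺b))
  (trans
    (cong (_xor false) (trans
      (cong (_xor negative (orient a b q))
        (nested-same-side d a≺p (≺-trans a≺p p≺q) p≺b q≺b (off-line d a≺p p≺b)
          (off-line (disjoint-flip d) (≺-trans a≺p p≺q) q≺b)))
      (xor-same (negative (orient a b q)))))
    (sym (xor₄ (before-false a≺p) (before-false (≺-trans a≺p p≺q))
               (before-true p≺b) (before-true q≺b))))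

-- Exchanging the segments negates each of the four `before` terms, and four negations cancel modulo
-- 2.
parity-sym : ∀ {a b p q} → p ≢ a → q ≢ a → p ≢ b → q ≢ b → Parity p q a b → Parity a b p q
parity-sym {a} {b} {p} {q} p≢a q≢a p≢b q≢b e = begin
  (crosses p a b xor crosses q a b) xor (crosses a p q xor crosses b p q)
    ≡⟨ xor-comm (crosses p a b xor crosses q a b) _ ⟩
  (crosses a p q xor crosses b p q) xor (crosses p a b xor crosses q a b)
    ≡⟨ e ⟩
  (before a p xor before b p) xor (before a q xor before b q)
    ≡⟨ xor₄ (before-not p≢a) (before-not p≢b) (before-not q≢a) (before-not q≢b) ⟩
  (not (before p a) xor not (before p b)) xor (not (before q a) xor not (before q b))
    ≡⟨ not₄ (before p a) (before p b) (before q a) (before q b) ⟩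
  (before p a xor before q a) xor (before p b xor before q b) ∎
  where
  open ≡-Reasoning
  not₂ : ∀ s t → not s xor not t ≡ s xor t
  not₂ false false = refl
  not₂ false true = refl
  not₂ true false = refl
  not₂ true true = refl
  not₄ : ∀ s t u v → (not s xor not t) xor (not u xor not v) ≡ (s xor u) xor (t xor v)
  not₄ false t u v = trans (cong₂ _xor_ (not₂ false t) (not₂ u v)) (assoc t u v)
    where
    assoc : ∀ t u v → t xor (u xor v) ≡ u xor (t xor v)
    assoc false u v = refl
    assoc true false v = refl
    assoc true true v = refl
  not₄ true t u v = trans (cong₂ _xor_ (not₂ true t) (not₂ u v)) (assoc t u v)
    where
    assoc : ∀ t u v → not t xor (u xor v) ≡ not u xor (t xor v)
    assoc false false v = refl
    assoc false true false = refl
    assoc false true true = refl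
    assoc true false false = refl
    assoc true false true = refl
    assoc true true v = refl

parity-flipˡ : ∀ {a b p q} → Parity b a p q → Parity a b p q
parity-flipˡ {a} {b} {p} {q} e = trans
  (cong₂ _xor_ (cong₂ _xor_ (xor-comm (under p a b) _) (xor-comm (under q a b) _))
               (xor-comm (crosses a p q) (crosses b p q)))
    (trans e (xor-comm (before p b xor before q b) _))

parity-flipʳ : ∀ {a b p q} → Parity a b q p → Parity a b p q
parity-flipʳ {a} {b} {p} {q} e = trans
  (cong₂ _xor_ (xor-comm (crosses p a b) _)
               (cong₂ _xor_ (xor-comm (under a p q) _) (xor-comm (under b p q) _)))
  (trans e (cong₂ _xor_ (xor-comm (before q a) _) (xor-comm (before q b) _)))

parity-degenerate : ∀ a p q → Parity a a p q
parity-degenerate a p q = trans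
  (cong₂ _xor_ (cong₂ _xor_ (xor-same (under p a a)) (xor-same (under q a a)))
               (xor-same (crosses a p q)))
  (sym (xor-same (before p a xor before q a)))

disjoint-flipˡ : ∀ {a b p q} → Disjoint a b p q → Disjoint b a p q
disjoint-flipˡ d = disjoint-sym (disjoint-flip (disjoint-sym d))

disjoint⇒≢ : ∀ {a b p q} → Disjoint a b p q → p ≢ a
disjoint⇒≢ {a₁ , a₂} {b₁ , b₂} {p = p₁ , p₂} {q₁ , q₂} d refl =
  d 0ℚ 0ℚ (ℚ.≤-refl , 0≤1) (ℚ.≤-refl , 0≤1)
    (cong₂ _,_ (trans (lerp-start a₁ b₁) (sym (lerp-start p₁ q₁)))
               (trans (lerp-start a₂ b₂) (sym (lerp-start p₂ q₂))))

parity-increasing : ∀ {a b p q} → Disjoint a b p q → a ≺ b → p ≺ q → Parity a b p q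
parity-increasing {a} {b} {p} {q} d a≺b p≺q with ≺-cmp a p
... | inj₁ a≺p = parity-ordered d a≺b p≺q a≺p (disjoint⇒≢ (disjoint-flipˡ d))
                   (disjoint⇒≢ (disjoint-flip (disjoint-flipˡ d)))
... | inj₂ (inj₁ e) = contradiction (sym e) (disjoint⇒≢ d)
... | inj₂ (inj₂ p≺a) = parity-sym (disjoint⇒≢ d) (disjoint⇒≢ (disjoint-flip d))
  (disjoint⇒≢ (disjoint-flipˡ d)) (disjoint⇒≢ (disjoint-flip (disjoint-flipˡ d)))
  (parity-ordered (disjoint-sym d) p≺q a≺b p≺a
    (disjoint⇒≢ (disjoint-flipˡ (disjoint-sym d)))
    (disjoint⇒≢ (disjoint-flip (disjoint-flipˡ (disjoint-sym d)))))

segment-parity : ∀ {a b p q} → Disjoint a b p q → Parity a b p q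
segment-parity {a} {b} {p} {q} d with ≺-cmp a b | ≺-cmp p q
... | inj₂ (inj₁ refl) | _ = parity-degenerate a p q
... | inj₁ _ | inj₂ (inj₁ refl) = parity-sym (disjoint⇒≢ d) (disjoint⇒≢ d)
  (disjoint⇒≢ (disjoint-flipˡ d)) (disjoint⇒≢ (disjoint-flipˡ d)) (parity-degenerate p a b)
... | inj₂ (inj₂ _) | inj₂ (inj₁ refl) = parity-sym (disjoint⇒≢ d) (disjoint⇒≢ d)
  (disjoint⇒≢ (disjoint-flipˡ d)) (disjoint⇒≢ (disjoint-flipˡ d)) (parity-degenerate p a b)
... | inj₁ a≺b | inj₁ p≺q = parity-increasing d a≺b p≺q
... | inj₁ a≺b | inj₂ (inj₂ q≺p) = parity-flipʳ (parity-increasing (disjoint-flip d) a≺b q≺p)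
... | inj₂ (inj₂ b≺a) | inj₁ p≺q = parity-flipˡ (parity-increasing (disjoint-flipˡ d) b≺a p≺q)
... | inj₂ (inj₂ b≺a) | inj₂ (inj₂ q≺p) = parity-flipˡ {a} {b}
  (parity-flipʳ {b} {a} (parity-increasing (disjoint-flip (disjoint-flipˡ d)) b≺a q≺p))

-- From segments to polygonal arcs

telescope : ∀ k (h : Fin (suc k) → Bool) →
            ⨁ (λ i → h (inject₁ i) xor h (suc i)) ≡ h zero xor h (fromℕ k)
telescope zero h = sym (xor-same (h zero))
telescope (suc k) h = begin
  (h zero xor h (suc zero)) xor ⨁ (λ i → h (suc (inject₁ i)) xor h (suc (suc i)))
    ≡⟨ cong ((h zero xor h (suc zero)) xor_) (telescope k (λ i → h (suc i))) ⟩
  (h zero xor h (suc zero)) xor (h (suc zero) xor h (suc (fromℕ k)))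
    ≡⟨ cancel (h zero) (h (suc zero)) ⟩
  h zero xor h (suc (fromℕ k)) ∎
  where
  open ≡-Reasoning
  cancel : ∀ s t {u} → (s xor t) xor (t xor u) ≡ s xor u
  cancel s t {u} = begin
    (s xor t) xor (t xor u)  ≡⟨ xor-assoc s t _ ⟩
    s xor (t xor (t xor u))  ≡⟨ cong (s xor_) (xor-assoc t t u) ⟨
    s xor ((t xor t) xor u)  ≡⟨ cong (λ z → s xor (z xor u)) (xor-same t) ⟩
    s xor u ∎

hits : ∀ {a b} → Arc a b → Point → Bool
hits γ p = ⨁ (λ i → crosses p (corner (inject₁ i)) (corner (suc i)))
  where open Arc γ

module _ {a b p q} (α : Arc a b) (β : Arc p q) where
  private
    module α = Arc α
    module β = Arc β

  arc-parity : (∀ i j s t → InUnit s → InUnit t → α.at i s ≢ β.at j t) →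
    (hits α p xor hits α q) xor (hits β a xor hits β b) ≡
    (before p a xor before q a) xor (before p b xor before q b)
  arc-parity disjoint =
    subst₂ (λ a b → ArcParity a b p q) α.source α.target
      (subst₂ (λ p q → ArcParity (A zero) (A (fromℕ k)) p q) β.source β.target corners)
    where
    open ≡-Reasoning
    ArcParity : (a b p q : Point) → Set
    ArcParity a b p q =
      (hits α p xor hits α q) xor (hits β a xor hits β b) ≡
      (before p a xor before q a) xor (before p b xor before q b)
    A = α.corner
    B = β.corner
    k = α.segments
    l = β.segments
    crossα : Fin k → Point → Bool
    crossα i z = crosses z (A (inject₁ i)) (A (suc i))
    crossβ : Fin l → Point → Bool
    crossβ j z = crosses z (B (inject₁ j)) (B (suc j))
    straddle : Fin l → Point → Bool
    straddle j z = before (B (inject₁ j)) z xor before (B (suc j)) z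

    -- An interior corner of `β` ends one piece and starts the next, so its ray is counted twice
    -- against each piece of `α`; only the rays from the two ends survive.
    αβ : ⨁ (λ i → ⨁ (λ j → crossα i (B (inject₁ j)) xor crossα i (B (suc j)))) ≡
         hits α (B zero) xor hits α (B (fromℕ l))
    αβ = trans (⨁-cong λ i → telescope l (λ j → crossα i (B j)))
               (⨁-distrib (λ i → crossα i (B zero)) (λ i → crossα i (B (fromℕ l))))

    βα : ⨁ (λ i → ⨁ (λ j → crossβ j (A (inject₁ i)) xor crossβ j (A (suc i)))) ≡
         hits β (A zero) xor hits β (A (fromℕ k))
    βα = trans (⨁-swap {k} {l} (λ i j → crossβ j (A (inject₁ i)) xor crossβ j (A (suc i))))
        (trans (⨁-cong λ j → telescope k (λ i → crossβ j (A i)))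
               (⨁-distrib (λ j → crossβ j (A zero)) (λ j → crossβ j (A (fromℕ k)))))

    straddling : ⨁ (λ i → ⨁ (λ j → straddle j (A (inject₁ i)) xor straddle j (A (suc i)))) ≡
      (before (B zero) (A zero) xor before (B (fromℕ l)) (A zero)) xor
      (before (B zero) (A (fromℕ k)) xor before (B (fromℕ l)) (A (fromℕ k)))
    straddling = trans
      (⨁-cong λ i → trans
        (⨁-distrib (λ j → straddle j (A (inject₁ i))) (λ j → straddle j (A (suc i))))
        (cong₂ _xor_ (telescope l (λ j → before (B j) (A (inject₁ i))))
                     (telescope l (λ j → before (B j) (A (suc i))))))
      (telescope k (λ i → before (B zero) (A i) xor before (B (fromℕ l)) (A i)))

    corners : ArcParity (A zero) (A (fromℕ k)) (B zero) (B (fromℕ l))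
    corners = begin
      _ ≡⟨ cong₂ _xor_ αβ βα ⟨
      _ ≡⟨ ⨁-distrib (λ i → ⨁ (λ j → crossα i (B (inject₁ j)) xor crossα i (B (suc j))))
             (λ i → ⨁ (λ j → crossβ j (A (inject₁ i)) xor crossβ j (A (suc i)))) ⟨
      _ ≡⟨ ⨁-cong (λ i → ⨁-distrib (λ j → crossα i (B (inject₁ j)) xor crossα i (B (suc j)))
             (λ j → crossβ j (A (inject₁ i)) xor crossβ j (A (suc i)))) ⟨
      _ ≡⟨ ⨁-cong (λ i → ⨁-cong λ j → segment-parity (disjoint i j)) ⟩
      _ ≡⟨ straddling ⟩
      _ ∎

-- Nonplanarity of K₅

-- Formal sums modulo 2, as lists of names of terms. Cancelling equal names by a decision procedure
-- lets the double counting for K₅ be checked by evaluation.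
module ParityCount {A : Set} (_≟_ : DecidableEquality A) where

  toggle : A → List A → List A
  toggle g [] = g ∷ []
  toggle g (h ∷ hs) with g ≟ h
  ... | yes _ = hs
  ... | no _ = h ∷ toggle g hs

  reduce : List A → List A
  reduce = foldr toggle []

  module _ (ρ : A → Bool) where

    parity : List A → Bool
    parity [] = false
    parity (g ∷ gs) = ρ g xor parity gs

    parity-toggle : ∀ g hs → parity (toggle g hs) ≡ ρ g xor parity hs
    parity-toggle g [] = refl
    parity-toggle g (h ∷ hs) with g ≟ h
    ... | yes refl = trans (cong (_xor parity hs) (sym (xor-same (ρ g)))) (xor-assoc (ρ g) (ρ g) _)
    ... | no _ = begin
      ρ h xor parity (toggle g hs)     ≡⟨ cong (ρ h xor_) (parity-toggle g hs) ⟩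
      ρ h xor (ρ g xor parity hs)      ≡⟨ xor-assoc (ρ h) (ρ g) _ ⟨
      (ρ h xor ρ g) xor parity hs      ≡⟨ cong (_xor parity hs) (xor-comm (ρ h) (ρ g)) ⟩
      (ρ g xor ρ h) xor parity hs      ≡⟨ xor-assoc (ρ g) (ρ h) _ ⟩
      ρ g xor (ρ h xor parity hs)      ∎
      where open ≡-Reasoning

    parity-reduce : ∀ gs → parity (reduce gs) ≡ parity gs
    parity-reduce [] = refl
    parity-reduce (g ∷ gs) = trans (parity-toggle g (reduce gs)) (cong (ρ g xor_) (parity-reduce gs))

    parity-++ : ∀ gs hs → parity (gs ++ hs) ≡ parity gs xor parity hs
    parity-++ [] hs = refl
    parity-++ (g ∷ gs) hs = trans (cong (ρ g xor_) (parity-++ gs hs)) (sym (xor-assoc (ρ g) _ _))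

    parity-concatMap : ∀ {B : Set} (f : B → List A) {bs} →
                       All (λ b → parity (f b) ≡ false) bs → parity (concatMap f bs) ≡ false
    parity-concatMap f [] = refl
    parity-concatMap f {b ∷ bs} (e ∷ es) =
      trans (parity-++ (f b) (concatMap f bs)) (cong₂ _xor_ e (parity-concatMap f es))

-- The conclusion of `arc-parity` with the hit counts abstracted. An arc is drawn from the smaller
-- to the larger end of its edge; in this form the ends can be exchanged while the arc stays the
-- same.
EndParity : (Point → Bool) → (Point → Bool) → (a b p q : Point) → Set
EndParity f g a b p q =
  (f p xor f q) xor (g a xor g b) ≡ (before p a xor before q a) xor (before p b xor before q b)

endParity-flipˡ : ∀ {f g a b p q} → EndParity f g b a p q → EndParity f g a b p q
endParity-flipˡ {f} {g} {a} {b} {p} {q} e =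
  trans (cong ((f p xor f q) xor_) (xor-comm (g a) (g b)))
    (trans e (xor-comm (before p b xor before q b) _))

endParity-flipʳ : ∀ {f g a b p q} → EndParity f g a b q p → EndParity f g a b p q
endParity-flipʳ {f} {g} {a} {b} {p} {q} e =
  trans (cong (_xor (g a xor g b)) (xor-comm (f p) (f q)))
    (trans e (cong₂ _xor_ (xor-comm (before q a) _) (xor-comm (before q b) _)))

module _ {n} (G : Graph (Fin n)) where
  open Graph G using (_~_) renaming (sym to adj-sym; irrefl to adj-irrefl)

  ~-sym : ∀ {u v} → u ~ v → v ~ u
  ~-sym {u} {v} e = trans (adj-sym v u) e

  ~⇒≢ : ∀ {u v} → u ~ v → u ≢ v
  ~⇒≢ {u} e refl with trans (sym e) (adj-irrefl u)
  ... | ()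

  Joins : Edge G → Fin n → Fin n → Set
  Joins e u v = (Edge.lo e ≡ u × Edge.hi e ≡ v) ⊎ (Edge.lo e ≡ v × Edge.hi e ≡ u)

  edge-between : ∀ u v → u ~ v → Σ (Edge G) λ e → Joins e u v
  edge-between u v e with Fin.<-cmp u v
  ... | tri< u<v _ _ = record { lo = u ; hi = v ; ordered = u<v ; adjacent = e } , inj₁ (refl , refl)
  ... | tri≈ _ u≡v _ = contradiction u≡v (~⇒≢ e)
  ... | tri> _ _ v<u =
    record { lo = v ; hi = u ; ordered = v<u ; adjacent = ~-sym e } , inj₂ (refl , refl)

module _ {n} {G : Graph (Fin n)} (D : PlaneDrawing G) where
  open Graph G using (_~_)
  open PlaneDrawing D
  open Edge using (lo; hi)

  -- `no-crossing` takes care of common points other than the ends of `e`. An end of `e` on the arc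
  -- of `f` is not an end of `f`, so it would be a vertex in the interior of that arc.
  arcs-disjoint : ∀ e f → lo e ≢ lo f → lo e ≢ hi f → hi e ≢ lo f → hi e ≢ hi f →
    ∀ i j s t → InUnit s → InUnit t → Arc.at (arc e) i s ≢ Arc.at (arc f) j t
  arcs-disjoint e f ll lh hl hh i j s t u v p≡q
    with ×-≡-dec ℚ._≟_ ℚ._≟_ (Arc.at (arc e) i s) (pos (lo e))
       | ×-≡-dec ℚ._≟_ ℚ._≟_ (Arc.at (arc e) i s) (pos (hi e))
  ... | yes p≡lo | _ = no-vertex f (lo e)
    ((j , t , v , trans (sym p≡q) p≡lo) , ll ∘ pos-distinct , lh ∘ pos-distinct)
  ... | no _ | yes p≡hi = no-vertex f (hi e)
    ((j , t , v , trans (sym p≡q) p≡hi) , hl ∘ pos-distinct , hh ∘ pos-distinct)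
  ... | no p≢lo | no p≢hi = no-crossing e f (ll ∘ cong proj₁) (Arc.at (arc e) i s)
    ((i , s , u , refl) , p≢lo , p≢hi) (j , t , v , sym p≡q)

  edge-parity : ∀ {a b p q} → a ≢ p → a ≢ q → b ≢ p → b ≢ q →
    ∀ e f → Joins G e a b → Joins G f p q →
    EndParity (hits (arc e)) (hits (arc f)) (pos a) (pos b) (pos p) (pos q)
  edge-parity ap aq bp bq e f (inj₁ (refl , refl)) (inj₁ (refl , refl)) =
    arc-parity (arc e) (arc f) (arcs-disjoint e f ap aq bp bq)
  edge-parity ap aq bp bq e f (inj₁ (refl , refl)) (inj₂ (refl , refl)) =
    endParity-flipʳ {hits (arc e)} {hits (arc f)}
      (arc-parity (arc e) (arc f) (arcs-disjoint e f aq ap bq bp))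
  edge-parity ap aq bp bq e f (inj₂ (refl , refl)) (inj₁ (refl , refl)) =
    endParity-flipˡ {hits (arc e)} {hits (arc f)}
      (arc-parity (arc e) (arc f) (arcs-disjoint e f bp bq ap aq))
  edge-parity ap aq bp bq e f (inj₂ (refl , refl)) (inj₂ (refl , refl)) =
    endParity-flipˡ {hits (arc e)} {hits (arc f)} (endParity-flipʳ {hits (arc e)} {hits (arc f)}
      (arc-parity (arc e) (arc f) (arcs-disjoint e f bq bp aq ap)))

  module _ (v : Fin 5 → Fin n) (complete : ∀ {i j} → i ≢ j → v i ~ v j) where

    private
      -- inj₁ (i , j , k) stands for the ray from vertex i against the arc of edge jk, and
      -- inj₂ (i , j) for vertex i being left of vertex j.
      Term : Set
      Term = (Fin 5 × Fin 5 × Fin 5) ⊎ (Fin 5 × Fin 5)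

      _≟ₜ_ : DecidableEquality Term
      _≟ₜ_ = ⊎-≡-dec (×-≡-dec Fin._≟_ (×-≡-dec Fin._≟_ Fin._≟_))
                       (×-≡-dec Fin._≟_ Fin._≟_)

      open ParityCount _≟ₜ_

      P : Fin 5 → Point
      P i = pos (v i)

      edgeHits : Fin 5 → Fin 5 → Point → Bool
      edgeHits i j with i Fin.≟ j
      -- A default for a non-edge; `Distinct` excludes it from every quadruple that is summed.
      ... | yes _ = λ _ → false
      ... | no i≢j = hits (arc (proj₁ (edge-between G (v i) (v j) (complete i≢j))))

      value : Term → Bool
      value (inj₁ (i , j , k)) = edgeHits j k (P i)
      value (inj₂ (i , j)) = before (P i) (P j)

      Quad : Set
      Quad = Fin 5 × Fin 5 × Fin 5 × Fin 5

      Distinct : Quad → Set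
      Distinct (i , j , k , l) = i ≢ j × k ≢ l × i ≢ k × i ≢ l × j ≢ k × j ≢ l

      distinct? : ∀ q → Dec (Distinct q)
      distinct? (i , j , k , l) =
        i ≠? j ×-dec k ≠? l ×-dec i ≠? k ×-dec i ≠? l ×-dec j ≠? k ×-dec j ≠? l
        where
        _≠?_ : ∀ (i j : Fin 5) → Dec (i ≢ j)
        i ≠? j = ¬? (i Fin.≟ j)

      terms : Quad → List Term
      terms (i , j , k , l) =
        inj₁ (k , i , j) ∷ inj₁ (l , i , j) ∷ inj₁ (i , k , l) ∷ inj₁ (j , k , l) ∷
        inj₂ (k , i) ∷ inj₂ (l , i) ∷ inj₂ (k , j) ∷ inj₂ (l , j) ∷ []

      v-injective : ∀ {i j} → i ≢ j → v i ≢ v j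
      v-injective i≢j = ~⇒≢ G (complete i≢j)

      quad-parity : ∀ q → Distinct q → parity value (terms q) ≡ false
      quad-parity (i , j , k , l) (i≢j , k≢l , i≢k , i≢l , j≢k , j≢l) =
        regroup (edgeHits i j (P k)) (edgeHits i j (P l)) (edgeHits k l (P i)) (edgeHits k l (P j))
                (before (P k) (P i)) (before (P l) (P i)) (before (P k) (P j)) (before (P l) (P j))
                quad
        where
        quad : EndParity (edgeHits i j) (edgeHits k l) (P i) (P j) (P k) (P l)
        quad with i Fin.≟ j | k Fin.≟ l
        ... | yes i≡j | _ = contradiction i≡j i≢j
        ... | no _ | yes k≡l = contradiction k≡l k≢l
        ... | no i≢j | no k≢l =
          edge-parity (v-injective i≢k) (v-injective i≢l) (v-injective j≢k) (v-injective j≢l)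
            _ _ (proj₂ (edge-between G (v i) (v j) (complete i≢j)))
                (proj₂ (edge-between G (v k) (v l) (complete k≢l)))
        flatten : ∀ s t u v w → (s xor t) xor (u xor v) xor w ≡ s xor (t xor (u xor (v xor w)))
        flatten s t u v w = trans (xor-assoc s t _)
          (cong (λ z → s xor (t xor z)) (xor-assoc u v w))
        regroup : ∀ s t u v s′ t′ u′ v′ →
          (s xor t) xor (u xor v) ≡ (s′ xor t′) xor (u′ xor v′) →
          s xor (t xor (u xor (v xor (s′ xor (t′ xor (u′ xor (v′ xor false))))))) ≡ false
        regroup s t u v s′ t′ u′ v′ e = begin
          _ ≡⟨ flatten s t u v _ ⟨
          (s xor t) xor ((u xor v) xor (s′ xor (t′ xor (u′ xor (v′ xor false)))))
            ≡⟨ xor-assoc (s xor t) (u xor v) _ ⟨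
          ((s xor t) xor (u xor v)) xor (s′ xor (t′ xor (u′ xor (v′ xor false))))
            ≡⟨ cong₂ _xor_ e (sym (flatten s′ t′ u′ v′ false)) ⟩
          ((s′ xor t′) xor (u′ xor v′)) xor ((s′ xor t′) xor ((u′ xor v′) xor false))
            ≡⟨ cong (λ z → ((s′ xor t′) xor (u′ xor v′)) xor ((s′ xor t′) xor z)) (xor-identityʳ _) ⟩
          ((s′ xor t′) xor (u′ xor v′)) xor ((s′ xor t′) xor (u′ xor v′))
            ≡⟨ xor-same ((s′ xor t′) xor (u′ xor v′)) ⟩
          false ∎
          where open ≡-Reasoning

      -- Both edges of a pair are written with increasing ends, so the ray from `i` against the edge
      -- `jk` has the same name in its two occurrences: with `jk` is paired the edge from `i` to
      -- either of the two remaining vertices.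
      disjointPairs : List Quad
      disjointPairs =
        (0F , 1F , 2F , 3F) ∷ (0F , 1F , 2F , 4F) ∷ (0F , 1F , 3F , 4F) ∷
        (0F , 2F , 1F , 3F) ∷ (0F , 2F , 1F , 4F) ∷ (0F , 2F , 3F , 4F) ∷
        (0F , 3F , 1F , 2F) ∷ (0F , 3F , 1F , 4F) ∷ (0F , 3F , 2F , 4F) ∷
        (0F , 4F , 1F , 2F) ∷ (0F , 4F , 1F , 3F) ∷ (0F , 4F , 2F , 3F) ∷
        (1F , 2F , 3F , 4F) ∷ (1F , 3F , 2F , 4F) ∷ (1F , 4F , 2F , 3F) ∷ []

      -- The left-right terms that occur an odd number of times in the sum.
      leftover : List Term
      leftover = inj₂ (2F , 3F) ∷ inj₂ (3F , 2F) ∷ inj₂ (2F , 4F) ∷ inj₂ (4F , 2F) ∷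
                 inj₂ (3F , 4F) ∷ inj₂ (4F , 3F) ∷ []

      -- Of two distinct points exactly one is left of the other, so each of the three pairs
      -- contributes 1.
      leftover-parity : parity value leftover ≡ true
      leftover-parity
        rewrite before-not {P 2F} {P 3F} (v-injective (λ ()) ∘ pos-distinct)
              | before-not {P 2F} {P 4F} (v-injective (λ ()) ∘ pos-distinct)
              | before-not {P 3F} {P 4F} (v-injective (λ ()) ∘ pos-distinct)
        with before (P 2F) (P 3F) | before (P 2F) (P 4F) | before (P 3F) (P 4F)
      ... | false | false | false = refl
      ... | false | false | true = refl
      ... | false | true | false = refl
      ... | false | true | true = refl
      ... | true | false | false = refl
      ... | true | false | true = refl
      ... | true | true | false = refl
      ... | true | true | true = refl

    K₅-not-plane : ⊥
    K₅-not-plane = contradiction (trans total-even total-odd) λ ()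
      where
      pairs-even : parity value (concatMap terms disjointPairs) ≡ false
      pairs-even = parity-concatMap value terms
        (All.map (λ {q} → quad-parity q) (toWitness {a? = all? distinct? disjointPairs} _))
      total-odd : parity value (concatMap terms disjointPairs ++ leftover) ≡ true
      total-odd = trans (parity-++ value (concatMap terms disjointPairs) leftover)
                        (cong₂ _xor_ pairs-even leftover-parity)
      total-even : false ≡ parity value (concatMap terms disjointPairs ++ leftover)
      -- Here `reduce` evaluates to the empty list: after `leftover` is appended, every name occurs
      -- an even number of times.
      total-even = parity-reduce value (concatMap terms disjointPairs ++ leftover)

-- Counting

𝟙 : Bool → ℕ
𝟙 true = 1
𝟙 false = 0

sum-mono : ∀ {n} {f g : Fin n → ℕ} → (∀ i → f i ≤ g i) → sum f ≤ sum g
sum-mono {zero} f≤g = z≤n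
sum-mono {suc n} f≤g = ℕ.+-mono-≤ (f≤g zero) (sum-mono (f≤g ∘ suc))

sum-const : ∀ n c → sum {n} (λ _ → c) ≡ n * c
sum-const zero c = refl
sum-const (suc n) c = cong (c +_) (sum-const n c)

δ : ∀ {n} → Fin n → Fin n → ℕ
δ i j = 𝟙 (does (i Fin.≟ j))

δ-≢ : ∀ {n} {i j : Fin n} → i ≢ j → δ i j ≡ 0
δ-≢ {i = i} {j} i≢j = cong 𝟙 (dec-false (i Fin.≟ j) i≢j)

sum-δ : ∀ {n} (j : Fin n) → sum (λ i → δ i j) ≡ 1
sum-δ {suc n} zero = cong suc (trans (sum-const n 0) (ℕ.*-zeroʳ n))
sum-δ (suc j) = sum-δ j

sum-*δ : ∀ {n} k (j : Fin n) → sum (λ i → k * δ i j) ≡ k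
sum-*δ k j = trans (sym (*-distribˡ-sum k (λ i → δ i j))) (trans (cong (k *_) (sum-δ j)) (ℕ.*-identityʳ k))

-- `τ v u` is the charge sent from `v` to `u`. Summed over all vertices, what is sent equals what is
-- received and cancels.
discharge : ∀ {n} (τ : Fin n → Fin n → ℕ) (f c : Fin n → ℕ) →
  (∀ v → f v + sum (λ u → τ u v) ≤ c v + sum (τ v)) → sum f ≤ sum c
discharge τ f c local = ℕ.+-cancelʳ-≤ (sum (λ v → sum (λ u → τ u v))) (sum f) (sum c) (begin
  sum f + sum (λ v → sum (λ u → τ u v))  ≡⟨ ∑-distrib-+ f _ ⟨
  sum (λ v → f v + sum (λ u → τ u v))    ≤⟨ sum-mono local ⟩
  sum (λ v → c v + sum (τ v))            ≡⟨ ∑-distrib-+ c _ ⟩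
  sum c + sum (λ v → sum (τ v))          ≡⟨ cong (sum c +_) (∑-comm τ) ⟩
  sum c + sum (λ v → sum (λ u → τ u v))  ∎)
  where open ℕ.≤-Reasoning

count : ∀ {n} → (Fin n → Bool) → ℕ
count p = sum (𝟙 ∘ p)

count-witness : ∀ {n} (p : Fin n → Bool) → 1 ≤ count p → ∃ λ u → p u ≡ true
count-witness {suc n} p le with p zero in eq
... | true = zero , eq
... | false with count-witness (p ∘ suc) le
...   | u , pu = suc u , pu

count-positive : ∀ {n} (p : Fin n → Bool) {u} → p u ≡ true → 1 ≤ count p
count-positive p {zero} pu rewrite pu = s≤s z≤n
count-positive p {suc u} pu = ℕ.≤-trans (count-positive (p ∘ suc) pu) (ℕ.m≤n+m _ (𝟙 (p zero)))

abstract
  pick : ∀ {n} (p : Fin n → Bool) (avoid : List (Fin n)) → length avoid < count p →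
         ∃ λ u → p u ≡ true × All (u ≢_) avoid
  pick p [] le with count-witness p le
  ... | u , pu = u , pu , []
  pick p (a ∷ as) le
    with pick (λ u → p u ∧ not (does (u Fin.≟ a))) as (ℕ.≤-pred (ℕ.≤-trans le split))
    where
    open ℕ.≤-Reasoning
    split′ : ∀ u → 𝟙 (p u) ≤ δ u a + 𝟙 (p u ∧ not (does (u Fin.≟ a)))
    split′ u with p u | does (u Fin.≟ a)
    ... | false | _ = z≤n
    ... | true | false = s≤s z≤n
    ... | true | true = s≤s z≤n
    split : count p ≤ suc (count (λ u → p u ∧ not (does (u Fin.≟ a))))
    split = begin
      count p  ≤⟨ sum-mono split′ ⟩
      sum (λ u → δ u a + 𝟙 (p u ∧ not (does (u Fin.≟ a))))  ≡⟨ ∑-distrib-+ (λ u → δ u a) _ ⟩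
      sum (λ u → δ u a) + count (λ u → p u ∧ not (does (u Fin.≟ a)))
        ≡⟨ cong (_+ count (λ u → p u ∧ not (does (u Fin.≟ a)))) (sum-δ a) ⟩
      suc (count (λ u → p u ∧ not (does (u Fin.≟ a))))  ∎
  ... | u , pu , u∉as with p u in eq | u Fin.≟ a
  ...   | true | no u≢a = u , eq , u≢a ∷ u∉as
  ...   | true | yes _ = contradiction pu λ ()
  ...   | false | _ = contradiction pu λ ()

  pickMany : ∀ {n} k (p : Fin n → Bool) (avoid : List (Fin n)) → k + length avoid ≤ count p →
    Σ (Fin k → Fin n) λ w → Injective _≡_ _≡_ w × (∀ i → p (w i) ≡ true) × (∀ i → All (w i ≢_) avoid)
  pickMany zero p avoid le = (λ ()) , (λ { {()} }) , (λ ()) , (λ ())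
  pickMany {n} (suc k) p avoid le with pick p avoid (ℕ.≤-trans (s≤s (ℕ.m≤n+m _ k)) le)
  ... | u , pu , u∉ with pickMany k p (u ∷ avoid) (subst (_≤ count p) (sym (ℕ.+-suc k _)) le)
  ...   | w , w-inj , pw , w∉ = w′ , (λ {i} {j} → w′-inj i j) , pw′ , w′∉
    where
    w′ : Fin (suc k) → Fin n
    w′ zero = u
    w′ (suc i) = w i
    w′-inj : ∀ i j → w′ i ≡ w′ j → i ≡ j
    w′-inj zero zero _ = refl
    w′-inj zero (suc j) e = contradiction (sym e) (All.head (w∉ j))
    w′-inj (suc i) zero e = contradiction e (All.head (w∉ i))
    w′-inj (suc i) (suc j) e = cong suc (w-inj e)
    pw′ : ∀ i → p (w′ i) ≡ true
    pw′ zero = pu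
    pw′ (suc i) = pw i
    w′∉ : ∀ i → All (w′ i ≢_) avoid
    w′∉ zero = u∉
    w′∉ (suc i) = All.tail (w∉ i)

-- Number of edges and sum of degrees

length-filter-tabulate : ∀ {A : Set} {P : Pred A 0ℓ} (P? : Decidable₁ P) {n} (f : Fin n → A) →
  length (filter P? (tabulate f)) ≡ sum (λ i → 𝟙 (does (P? (f i))))
length-filter-tabulate P? {zero} f = refl
length-filter-tabulate P? {suc n} f with does (P? (f zero))
... | true = cong suc (length-filter-tabulate P? (f ∘ suc))
... | false = length-filter-tabulate P? (f ∘ suc)

length-filter-cartesianProduct : ∀ {A B : Set} {P : Pred (A × B) 0ℓ} (P? : Decidable₁ P) {m n}
  (f : Fin m → A) (g : Fin n → B) →
  length (filter P? (cartesianProduct (tabulate f) (tabulate g))) ≡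
  sum (λ i → sum (λ j → 𝟙 (does (P? (f i , g j)))))
length-filter-cartesianProduct P? {zero} f g = refl
length-filter-cartesianProduct P? {suc m} f g = begin
  length (filter P? (map (f zero ,_) (tabulate g) ++ rest))
    ≡⟨ cong length (List.filter-++ P? (map (f zero ,_) (tabulate g)) rest) ⟩
  length (filter P? (map (f zero ,_) (tabulate g)) ++ filter P? rest)
    ≡⟨ List.length-++ (filter P? (map (f zero ,_) (tabulate g))) ⟩
  length (filter P? (map (f zero ,_) (tabulate g))) + length (filter P? rest)
    ≡⟨ cong₂ _+_
         (trans (cong (length ∘ filter P?) (List.map-tabulate g (f zero ,_)))
                (length-filter-tabulate P? (λ j → f zero , g j)))
         (length-filter-cartesianProduct P? (f ∘ suc) g) ⟩
  sum (λ j → 𝟙 (does (P? (f zero , g j)))) + sum (λ i → sum (λ j → 𝟙 (does (P? (f (suc i) , g j)))))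
    ∎
  where
  open ≡-Reasoning
  rest = cartesianProduct (tabulate (f ∘ suc)) (tabulate g)

module _ {n} (G : Graph (Fin n)) where
  open Graph G using (adj; _~_) renaming (sym to adj-sym; irrefl to adj-irrefl)

  deg : Fin n → ℕ
  deg v = count (adj v)

  edge? : (uv : Fin n × Fin n) → Dec (proj₁ uv Fin.< proj₂ uv × adj (proj₁ uv) (proj₂ uv) ≡ true)
  edge? (u , v) = (u Fin.<? v) ×-dec (adj u v Bool.≟ true)

  numEdges-sum : numEdges G ≡ sum (λ u → sum (λ v → 𝟙 (does (edge? (u , v)))))
  numEdges-sum = length-filter-cartesianProduct edge? id id

  handshake : 2 * numEdges G ≡ sum deg
  handshake = begin
    2 * numEdges G
      ≡⟨ cong (2 *_) numEdges-sum ⟩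
    2 * sum (λ u → sum (E u))
      ≡⟨ cong (sum (λ u → sum (E u)) +_) (ℕ.+-identityʳ _) ⟩
    sum (λ u → sum (E u)) + sum (λ u → sum (E u))
      ≡⟨ cong (sum (λ u → sum (E u)) +_) (∑-comm E) ⟩
    sum (λ u → sum (E u)) + sum (λ u → sum (λ v → E v u))
      ≡⟨ ∑-distrib-+ (λ u → sum (E u)) _ ⟨
    sum (λ u → sum (E u) + sum (λ v → E v u))
      ≡⟨ sum-cong-≗ (λ u → sym (∑-distrib-+ (E u) _)) ⟩
    sum (λ u → sum (λ v → E u v + E v u))
      ≡⟨ sum-cong-≗ (λ u → sum-cong-≗ (orientations u)) ⟩
    sum deg ∎
    where
    open ≡-Reasoning
    E : Fin n → Fin n → ℕ
    E u v = 𝟙 (does (edge? (u , v)))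
    does-true : ∀ b → does (b Bool.≟ true) ≡ b
    does-true true = refl
    does-true false = refl
    E-< : ∀ {u v} → u Fin.< v → E u v ≡ 𝟙 (adj u v)
    E-< {u} {v} u<v = cong 𝟙 (cong₂ _∧_ (dec-true (u Fin.<? v) u<v) (does-true (adj u v)))
    E-≮ : ∀ {u v} → ¬ u Fin.< v → E u v ≡ 0
    E-≮ {u} {v} u≮v = cong (λ b → 𝟙 (b ∧ does (adj u v Bool.≟ true))) (dec-false (u Fin.<? v) u≮v)
    orientations : ∀ u v → E u v + E v u ≡ 𝟙 (adj u v)
    orientations u v with Fin.<-cmp u v
    ... | tri< u<v _ v≮u = trans (cong₂ _+_ (E-< u<v) (E-≮ v≮u)) (ℕ.+-identityʳ _)
    ... | tri≈ u≮u refl _ = trans (cong₂ _+_ (E-≮ u≮u) (E-≮ u≮u)) (cong 𝟙 (sym (adj-irrefl u)))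
    ... | tri> u≮v _ v<u = trans (cong₂ _+_ (E-≮ u≮v) (E-< v<u)) (cong 𝟙 (adj-sym v u))

-- Upper bound

module _ {n} (G : Graph (Fin n)) where
  open Graph G using (adj; _~_)

  module _ (free : Free (doubleStar 2 2) G) where

    no-double-star : ∀ {a b} (w z : Fin 2 → Fin n) → Injective _≡_ _≡_ w → Injective _≡_ _≡_ z →
      a ~ b → (∀ i → a ~ w i) → (∀ i → b ~ z i) →
      (∀ i → w i ≢ b) → (∀ i → z i ≢ a) → (∀ i j → w i ≢ z j) → ⊥
    no-double-star {a} {b} w z w-inj z-inj ab aw bz w≢b z≢a w≢z =
      free (record { embed = φ ; injective = λ {s} {t} → φ-injective s t ; preserves = λ {s} {t} → φ-adj s t })
      where
      φ : StarVertex 2 2 → Fin n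
      φ x = a
      φ y = b
      φ (xleaf i) = w i
      φ (yleaf i) = z i
      φ-injective : ∀ s t → φ s ≡ φ t → s ≡ t
      φ-injective x x _ = refl
      φ-injective x y e = contradiction e (~⇒≢ G ab)
      φ-injective x (xleaf i) e = contradiction e (~⇒≢ G (aw i))
      φ-injective x (yleaf i) e = contradiction (sym e) (z≢a i)
      φ-injective y x e = contradiction (sym e) (~⇒≢ G ab)
      φ-injective y y _ = refl
      φ-injective y (xleaf i) e = contradiction (sym e) (w≢b i)
      φ-injective y (yleaf i) e = contradiction e (~⇒≢ G (bz i))
      φ-injective (xleaf i) x e = contradiction (sym e) (~⇒≢ G (aw i))
      φ-injective (xleaf i) y e = contradiction e (w≢b i)
      φ-injective (xleaf i) (xleaf j) e = cong xleaf (w-inj e)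
      φ-injective (xleaf i) (yleaf j) e = contradiction e (w≢z i j)
      φ-injective (yleaf i) x e = contradiction e (z≢a i)
      φ-injective (yleaf i) y e = contradiction (sym e) (~⇒≢ G (bz i))
      φ-injective (yleaf i) (xleaf j) e = contradiction (sym e) (w≢z j i)
      φ-injective (yleaf i) (yleaf j) e = cong yleaf (z-inj e)
      φ-adj : ∀ s t → Graph._~_ (doubleStar 2 2) s t → φ s ~ φ t
      φ-adj x y _ = ab
      φ-adj y x _ = ~-sym G ab
      φ-adj x (xleaf i) _ = aw i
      φ-adj (xleaf i) x _ = ~-sym G (aw i)
      φ-adj y (yleaf i) _ = bz i
      φ-adj (yleaf i) y _ = ~-sym G (bz i)

    -- Otherwise choose two leaves at `b` first. They and `b` exclude at most three neighbours of
    -- `a`, which leaves two of five as leaves at `a`.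
    neighbour-of-hub : ∀ {a b} → 5 ≤ deg G a → a ~ b → deg G b ≤ 2
    neighbour-of-hub {a} {b} 5≤ ab with 3 ℕ.≤? deg G b
    ... | no 3≰ = ℕ.≤-pred (ℕ.≰⇒> 3≰)
    ... | yes 3≤ with pickMany 2 (adj b) (a ∷ []) 3≤
    ...   | z , z-inj , bz , z∉ with pickMany 2 (adj a) (b ∷ z 0F ∷ z 1F ∷ []) 5≤
    ...     | w , w-inj , aw , w∉ = ⊥-elim (no-double-star w z w-inj z-inj ab aw bz
              (All.head ∘ w∉) (All.head ∘ z∉) w≢z)
      where
      w≢z : ∀ i j → w i ≢ z j
      w≢z i 0F = All.head (All.tail (w∉ i))
      w≢z i 1F = All.head (All.tail (All.tail (w∉ i)))

    -- If `t` were not adjacent to `a`, using it as a leaf at `b` would cost `a` no neighbour. Only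
    -- `b` and the other leaf `s` are then excluded, and two of four neighbours of `a` remain.
    neighbourhood-⊆ : ∀ {a b t} → 4 ≤ deg G a → 3 ≤ deg G b → a ~ b → b ~ t → t ≢ a → a ~ t
    neighbourhood-⊆ {a} {b} {t} 4≤ 3≤ ab bt t≢a with adj a t in at
    ... | true = refl
    ... | false with pick (adj b) (a ∷ t ∷ []) 3≤
    ...   | s , bs , s≢a ∷ s≢t ∷ [] with pickMany 2 (adj a) (b ∷ s ∷ []) 4≤
    ...     | w , w-inj , aw , w∉ = ⊥-elim (no-double-star w z w-inj (λ {i} {j} → z-inj i j) ab aw bz
              (All.head ∘ w∉) z≢a w≢z)
      where
      z : Fin 2 → Fin n
      z 0F = t
      z 1F = s
      z-inj : ∀ i j → z i ≡ z j → i ≡ j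
      z-inj 0F 0F _ = refl
      z-inj 0F 1F e = contradiction (sym e) s≢t
      z-inj 1F 0F e = contradiction e s≢t
      z-inj 1F 1F _ = refl
      bz : ∀ i → b ~ z i
      bz 0F = bt
      bz 1F = bs
      z≢a : ∀ i → z i ≢ a
      z≢a 0F = t≢a
      z≢a 1F = s≢a
      w≢z : ∀ i j → w i ≢ z j
      w≢z i 0F e with trans (sym (aw i)) (trans (cong (adj a) e) at)
      ... | ()
      w≢z i 1F = All.head (All.tail (w∉ i))

does-true : ∀ {P : Set} (d : Dec P) → does d ≡ true → P
does-true (yes p) _ = p

does-false : ∀ {P : Set} (d : Dec P) → does d ≡ false → ¬ P
does-false (no ¬p) _ = ¬p

true-or-false : ∀ b → b ≡ true ⊎ b ≡ false
true-or-false true = inj₁ refl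
true-or-false false = inj₂ refl

∧-trueˡ : ∀ b {c} → b ∧ c ≡ true → b ≡ true
∧-trueˡ true _ = refl

∧-trueʳ : ∀ b {c} → b ∧ c ≡ true → c ≡ true
∧-trueʳ true e = e

sum-zero : ∀ {n} {f : Fin n → ℕ} → (∀ i → f i ≡ 0) → sum f ≡ 0
sum-zero {n} f≡0 = trans (sum-cong-≗ f≡0) (trans (sum-const n 0) (ℕ.*-zeroʳ n))

module UpperBound {n} (G : Graph (Fin n)) (free : Free (doubleStar 2 2) G)
  (no-K₅ : (v : Fin 5 → Fin n) → ¬ (∀ {i j} → i ≢ j → Graph._~_ G (v i) (v j))) where
  open Graph G using (adj; _~_) renaming (sym to adj-sym; irrefl to adj-irrefl)

  private
    d : Fin n → ℕ
    d = deg G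

  -- Discharging when all degrees are at most four

  module SmallDegrees (d≤4 : ∀ v → d v ≤ 4) where

    high : Fin n → Bool
    high v = does (3 ℕ.≤? d v)

    high-degree : Fin n → ℕ
    high-degree v = count (λ u → adj v u ∧ high u)

    low-degree : Fin n → ℕ
    low-degree v = count (λ u → adj v u ∧ not (high u))

    full : Fin n → Bool
    full v = does (high-degree v ℕ.≟ 4)

    full-degree : Fin n → ℕ
    full-degree v = count (λ u → adj v u ∧ full u)

    half-degree : Fin n → ℕ
    half-degree v = count (λ u → adj v u ∧ (high u ∧ not (full u)))

    degree-split : ∀ v → d v ≡ high-degree v + low-degree v
    degree-split v = trans (sum-cong-≗ (λ u → split (adj v u) (high u)))
                           (∑-distrib-+ (λ u → 𝟙 (adj v u ∧ high u)) _)
      where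
      split : ∀ b c → 𝟙 b ≡ 𝟙 (b ∧ c) + 𝟙 (b ∧ not c)
      split false _ = refl
      split true false = refl
      split true true = refl

    full⇒4≤d : ∀ {v} → full v ≡ true → 4 ≤ d v
    full⇒4≤d {v} fv = subst₂ _≤_ (does-true (high-degree v ℕ.≟ 4) fv) (sym (degree-split v))
                             (ℕ.m≤m+n (high-degree v) (low-degree v))

    high⇒3≤d : ∀ {v} → high v ≡ true → 3 ≤ d v
    high⇒3≤d {v} = does-true (3 ℕ.≤? d v)

    full⇒high : ∀ {v} → full v ≡ true → high v ≡ true
    full⇒high {v} fv = dec-true (3 ℕ.≤? d v) (ℕ.≤-trans (ℕ.n≤1+n 3) (full⇒4≤d fv))

    neighbour-of-full : ∀ {u t} → full u ≡ true → u ~ t → high t ≡ true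
    neighbour-of-full {u} {t} fu ut with high t in eq
    ... | true = refl
    ... | false = contradiction (d≤4 u) (ℕ.<⇒≱ (begin-strict
      4                                 <⟨ ℕ.m<m+n 4 (count-positive _ {t} (cong₂ _∧_ ut (cong not eq))) ⟩
      4 + low-degree u                  ≡⟨ cong (_+ low-degree u) (does-true (high-degree u ℕ.≟ 4) fu) ⟨
      high-degree u + low-degree u      ≡⟨ degree-split u ⟨
      d u                               ∎))
      where open ℕ.≤-Reasoning

    -- A full neighbour w of v has N[v] ⊆ N[w], so three full neighbours of v and its fourth
    -- neighbour complete it to a K₅.
    two-half-neighbours : ∀ {v} → full v ≡ true → 2 ≤ half-degree v
    two-half-neighbours {v} fv with 2 ℕ.≤? half-degree v
    ... | yes 2≤ = 2≤
    ... | no 2≰ = ⊥-elim (clique (pickMany 3 (λ u → adj v u ∧ full u) [] three))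
      where
      open ℕ.≤-Reasoning
      pointwise : ∀ b c e → 𝟙 (b ∧ c) ≤ 𝟙 (b ∧ e) + 𝟙 (b ∧ (c ∧ not e))
      pointwise false _ _ = z≤n
      pointwise true false _ = z≤n
      pointwise true true false = s≤s z≤n
      pointwise true true true = s≤s z≤n
      three : 3 ≤ full-degree v
      three = ℕ.+-cancelʳ-≤ 1 3 (full-degree v) (begin
        4              ≡⟨ does-true (high-degree v ℕ.≟ 4) fv ⟨
        high-degree v  ≤⟨ sum-mono (λ u → pointwise (adj v u) (high u) (full u)) ⟩
        sum (λ u → 𝟙 (adj v u ∧ full u) + 𝟙 (adj v u ∧ (high u ∧ not (full u))))
                       ≡⟨ ∑-distrib-+ (λ u → 𝟙 (adj v u ∧ full u)) _ ⟩
        full-degree v + half-degree v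
                       ≤⟨ ℕ.+-monoʳ-≤ (full-degree v) (ℕ.≤-pred (ℕ.≰⇒> 2≰)) ⟩
        full-degree v + 1 ∎)
      module _ (w : Fin 3 → Fin n) (w-inj : Injective _≡_ _≡_ w)
               (vwf : ∀ i → adj v (w i) ∧ full (w i) ≡ true)
               (z : Fin n) (vz : v ~ z) (z∉ : All (z ≢_) (w 0F ∷ w 1F ∷ w 2F ∷ [])) where
        vw : ∀ i → v ~ w i
        vw i = ∧-trueˡ (adj v (w i)) (vwf i)
        w-joined : ∀ i {t} → v ~ t → t ≢ w i → w i ~ t
        w-joined i = neighbourhood-⊆ G free (full⇒4≤d (∧-trueʳ (adj v (w i)) (vwf i)))
          (ℕ.≤-trans (ℕ.n≤1+n 3) (full⇒4≤d fv)) (~-sym G (vw i))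
        z≢w : ∀ i → z ≢ w i
        z≢w 0F = All.head z∉
        z≢w 1F = All.head (All.tail z∉)
        z≢w 2F = All.head (All.tail (All.tail z∉))
        κ : Fin 5 → Fin n
        κ 0F = v
        κ 1F = z
        κ (suc (suc i)) = w i
        κ-complete : ∀ i j → i ≢ j → κ i ~ κ j
        κ-complete 0F 0F i≢j = contradiction refl i≢j
        κ-complete 0F 1F _ = vz
        κ-complete 0F (suc (suc j)) _ = vw j
        κ-complete 1F 0F _ = ~-sym G vz
        κ-complete 1F 1F i≢j = contradiction refl i≢j
        κ-complete 1F (suc (suc j)) _ = ~-sym G (w-joined j vz (z≢w j))
        κ-complete (suc (suc i)) 0F _ = ~-sym G (vw i)
        κ-complete (suc (suc i)) 1F _ = w-joined i vz (z≢w i)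
        κ-complete (suc (suc i)) (suc (suc j)) i≢j =
          w-joined i (vw j) (λ e → i≢j (cong (Fin.suc {4} ∘ Fin.suc {3}) (sym (w-inj e))))
      clique : Σ (Fin 3 → Fin n) (λ w → Injective _≡_ _≡_ w ×
                 (∀ i → adj v (w i) ∧ full (w i) ≡ true) × _) → ⊥
      clique (w , w-inj , vwf , _) with pick (adj v) (w 0F ∷ w 1F ∷ w 2F ∷ []) (full⇒4≤d fv)
      ... | z , vz , z∉ = no-K₅ (κ w w-inj vwf z vz z∉) (λ {i} {j} → κ-complete w w-inj vwf z vz z∉ i j)

    -- In units of a fifth of an edge end.
    transfer : Fin n → Fin n → ℕ
    transfer v u = 4 * 𝟙 (adj v u ∧ (high v ∧ not (high u))) +
                   𝟙 (adj v u ∧ (full v ∧ (high u ∧ not (full u))))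

    private
      -- Bounds on what one neighbour sends, by the type of the receiver. Here `c` and `e` say
      -- whether the sender is high and full, `g` whether the receiver is high, and `h` encodes
      -- whether the receiver is full.
      in-low : ∀ {b b′} c e {g h} → b ≡ b′ → g ≡ false →
        4 * 𝟙 (b ∧ (c ∧ not g)) + 𝟙 (b ∧ (e ∧ (g ∧ h))) ≤ 4 * 𝟙 b′
      in-low {false} _ _ refl refl = z≤n
      in-low {true} false false refl refl = z≤n
      in-low {true} false true refl refl = z≤n
      in-low {true} true false refl refl = ℕ.≤-refl
      in-low {true} true true refl refl = ℕ.≤-refl

      in-high : ∀ {b b′} c e {g} h → b ≡ b′ → g ≡ true →
        4 * 𝟙 (b ∧ (c ∧ not g)) + 𝟙 (b ∧ (e ∧ (g ∧ h))) ≤ 𝟙 (b′ ∧ e)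
      in-high {false} _ _ _ refl refl = z≤n
      in-high {true} false false _ refl refl = z≤n
      in-high {true} false true false refl refl = z≤n
      in-high {true} false true true refl refl = ℕ.≤-refl
      in-high {true} true false _ refl refl = z≤n
      in-high {true} true true false refl refl = z≤n
      in-high {true} true true true refl refl = ℕ.≤-refl

      in-full : ∀ b c e {g h} → g ≡ true → h ≡ true →
        4 * 𝟙 (b ∧ (c ∧ not g)) + 𝟙 (b ∧ (e ∧ (g ∧ not h))) ≡ 0
      in-full false _ _ refl refl = refl
      in-full true false false refl refl = refl
      in-full true false true refl refl = refl
      in-full true true false refl refl = refl
      in-full true true true refl refl = refl

    -- With at most two neighbours, each sending at most 4, the balance is at worst 5·2 + 2 + 4·2 =
    -- 20.
    local-low : ∀ v → high v ≡ false → (5 * d v + 2) + sum (λ u → transfer u v) ≤ 20 + sum (transfer v)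
    local-low v lv = begin
      (5 * d v + 2) + sum (λ u → transfer u v)
        ≤⟨ ℕ.+-mono-≤ (ℕ.+-monoˡ-≤ 2 (ℕ.*-monoʳ-≤ 5 d≤2)) received ⟩
      20 ≤⟨ ℕ.m≤m+n 20 _ ⟩
      20 + sum (transfer v) ∎
      where
      open ℕ.≤-Reasoning
      d≤2 : d v ≤ 2
      d≤2 = ℕ.≤-pred (ℕ.≰⇒> (does-false (3 ℕ.≤? d v) lv))
      received : sum (λ u → transfer u v) ≤ 8
      received = begin
        sum (λ u → transfer u v)        ≤⟨ sum-mono (λ u → in-low (high u) (full u) (adj-sym u v) lv) ⟩
        sum (λ u → 4 * 𝟙 (adj v u))     ≡⟨ *-distribˡ-sum 4 (𝟙 ∘ adj v) ⟨
        4 * d v                         ≤⟨ ℕ.*-monoʳ-≤ 4 d≤2 ⟩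
        8 ∎

    -- A full vertex receives nothing and starts with at most 22; the excess of 2 goes to two half
    -- neighbours.
    local-full : ∀ v → full v ≡ true → (5 * d v + 2) + sum (λ u → transfer u v) ≤ 20 + sum (transfer v)
    local-full v fv = begin
      (5 * d v + 2) + sum (λ u → transfer u v)
        ≡⟨ cong ((5 * d v + 2) +_) (sum-zero (λ u → in-full (adj u v) (high u) (full u) (full⇒high fv) fv)) ⟩
      (5 * d v + 2) + 0      ≤⟨ ℕ.+-monoˡ-≤ 0 (ℕ.+-monoˡ-≤ 2 (ℕ.*-monoʳ-≤ 5 (d≤4 v))) ⟩
      20 + 2                 ≤⟨ ℕ.+-monoʳ-≤ 20 (two-half-neighbours fv) ⟩
      20 + half-degree v     ≤⟨ ℕ.+-monoʳ-≤ 20 (sum-mono sent) ⟩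
      20 + sum (transfer v)  ∎
      where
      open ℕ.≤-Reasoning
      sent : ∀ u → 𝟙 (adj v u ∧ (high u ∧ not (full u))) ≤ transfer v u
      sent u = ℕ.≤-trans
        (ℕ.≤-reflexive (cong (λ b → 𝟙 (adj v u ∧ (b ∧ (high u ∧ not (full u))))) (sym fv)))
        (ℕ.m≤n+m _ (4 * 𝟙 (adj v u ∧ (high v ∧ not (high u)))))

    -- If `v` has a full neighbour `u`, then its neighbours lie in the closed neighbourhood of `u`
    -- and are all high. As `v` is not full, its degree is at most 3, and it receives at most 3.
    -- Otherwise `v` receives nothing, and degree 4 forces a low neighbour, to which it sends 4.
    local-half : ∀ v → high v ≡ true → full v ≡ false →
                 (5 * d v + 2) + sum (λ u → transfer u v) ≤ 20 + sum (transfer v)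
    local-half v hv fv = ℕ.≤-trans
      (ℕ.+-monoʳ-≤ (5 * d v + 2)
        (sum-mono λ u → in-high (high u) (full u) (not (full v)) (adj-sym u v) hv))
      (ℕ.≤-trans (settle (1 ℕ.≤? full-degree v)) (ℕ.+-monoʳ-≤ 20 paid))
      where
      open ℕ.≤-Reasoning
      h≤d : high-degree v ≤ d v
      h≤d = subst (high-degree v ≤_) (sym (degree-split v)) (ℕ.m≤m+n _ _)
      h≤3 : high-degree v ≤ 3
      h≤3 = ℕ.≤-pred (ℕ.≤∧≢⇒< (ℕ.≤-trans h≤d (d≤4 v)) (does-false (high-degree v ℕ.≟ 4) fv))
      sent : ∀ u → 4 * 𝟙 (adj v u ∧ not (high u)) ≤ transfer v u
      sent u = ℕ.≤-trans
        (ℕ.≤-reflexive (cong (λ b → 4 * 𝟙 (adj v u ∧ (b ∧ not (high u)))) (sym hv)))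
        (ℕ.m≤m+n _ _)
      paid : 4 * low-degree v ≤ sum (transfer v)
      paid = ℕ.≤-trans (ℕ.≤-reflexive (*-distribˡ-sum 4 (λ u → 𝟙 (adj v u ∧ not (high u))))) (sum-mono sent)
      full-degree≤d : full-degree v ≤ d v
      full-degree≤d = sum-mono (λ u → pointwise (adj v u) (full u))
        where
        pointwise : ∀ b c → 𝟙 (b ∧ c) ≤ 𝟙 b
        pointwise false _ = z≤n
        pointwise true false = z≤n
        pointwise true true = ℕ.≤-refl
      no-low : 1 ≤ full-degree v → low-degree v ≡ 0
      no-low 1≤ with count-witness (λ u → adj v u ∧ full u) 1≤
      ... | u , vuf = sum-zero zeros
        where
        vu : v ~ u
        vu = ∧-trueˡ (adj v u) vuf
        fu : full u ≡ true
        fu = ∧-trueʳ (adj v u) vuf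
        all-high : ∀ t → v ~ t → high t ≡ true
        all-high t vt with t Fin.≟ u
        ... | yes refl = full⇒high fu
        ... | no t≢u = neighbour-of-full fu
          (neighbourhood-⊆ G free (full⇒4≤d fu) (high⇒3≤d hv) (~-sym G vu) vt t≢u)
        zeros : ∀ t → 𝟙 (adj v t ∧ not (high t)) ≡ 0
        zeros t with adj v t in vt
        ... | false = refl
        ... | true = cong (𝟙 ∘ not) (all-high t vt)
      settle : Dec (1 ≤ full-degree v) → (5 * d v + 2) + full-degree v ≤ 20 + 4 * low-degree v
      -- The worst case is 5·3 + 2 + 3 = 20.
      settle (yes 1≤) = ℕ.≤-trans
        (ℕ.+-mono-≤ (ℕ.+-monoˡ-≤ 2 (ℕ.*-monoʳ-≤ 5 d≤3)) (ℕ.≤-trans full-degree≤d d≤3))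
        (ℕ.m≤m+n 20 _)
        where
        d≤3 : d v ≤ 3
        d≤3 = subst (_≤ 3) (sym (trans (degree-split v)
          (trans (cong (high-degree v +_) (no-low 1≤)) (ℕ.+-identityʳ _)))) h≤3
      settle (no 1≰) = begin
        (5 * d v + 2) + full-degree v
          ≡⟨ cong ((5 * d v + 2) +_) (ℕ.n≤0⇒n≡0 (ℕ.≤-pred (ℕ.≰⇒> 1≰))) ⟩
        (5 * d v + 2) + 0
          ≡⟨ split-off (d v) ⟩
        4 * d v + d v + 2
          -- Only one of the five copies of the degree is estimated; the other four are split so
          -- that the low neighbours match the charge sent to them.
          ≤⟨ ℕ.+-monoˡ-≤ 2 (ℕ.+-monoʳ-≤ (4 * d v) (d≤4 v)) ⟩
        4 * d v + 4 + 2
          ≡⟨ cong (λ k → 4 * k + 4 + 2) (degree-split v) ⟩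
        4 * (high-degree v + low-degree v) + 4 + 2
          ≡⟨ expand (high-degree v) (low-degree v) ⟩
        4 * high-degree v + 6 + 4 * low-degree v
          ≤⟨ ℕ.+-monoˡ-≤ (4 * low-degree v) (ℕ.+-monoˡ-≤ 6 (ℕ.*-monoʳ-≤ 4 h≤3)) ⟩
        18 + 4 * low-degree v
          ≤⟨ ℕ.+-monoˡ-≤ (4 * low-degree v) (ℕ.m≤m+n 18 2) ⟩
        20 + 4 * low-degree v ∎
        where
        split-off : ∀ d → (5 * d + 2) + 0 ≡ 4 * d + d + 2
        split-off = solve-∀
        expand : ∀ h l → 4 * (h + l) + 4 + 2 ≡ 4 * h + 6 + 4 * l
        expand = solve-∀

    local : ∀ v → (5 * d v + 2) + sum (λ u → transfer u v) ≤ 20 + sum (transfer v)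
    local v with true-or-false (high v) | true-or-false (full v)
    ... | inj₂ lv | _ = local-low v lv
    ... | inj₁ _ | inj₁ fv = local-full v fv
    ... | inj₁ hv | inj₂ fv = local-half v hv fv

    small-degrees-bound : 5 * (2 * numEdges G) + n * 2 ≤ n * 20
    small-degrees-bound = begin
      5 * (2 * numEdges G) + n * 2
        ≡⟨ cong₂ _+_ (trans (cong (5 *_) (handshake G)) (*-distribˡ-sum 5 d)) (sym (sum-const n 2)) ⟩
      sum (λ v → 5 * d v) + sum {n} (λ _ → 2)
        ≡⟨ ∑-distrib-+ (λ v → 5 * d v) (λ _ → 2) ⟨
      sum (λ v → 5 * d v + 2)
        ≤⟨ discharge transfer _ (λ _ → 20) local ⟩
      sum {n} (λ _ → 20)
        ≡⟨ sum-const n 20 ⟩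
      n * 20 ∎
      where open ℕ.≤-Reasoning

  -- Vertices of degree at least five

  one-hub-bound : ∀ {c} → 5 ≤ d c → (∀ v → v ≢ c → d v ≤ 4) → 2 * numEdges G + 8 ≤ n * 4
  one-hub-bound {c} 5≤ others = ℕ.+-cancelʳ-≤ (d c) _ _ (begin
    2 * numEdges G + 8 + d c
      ≤⟨ ℕ.+-monoˡ-≤ (d c) (ℕ.+-monoʳ-≤ (2 * numEdges G) (ℕ.≤-trans (ℕ.n≤1+n 8) (ℕ.+-monoˡ-≤ 4 5≤))) ⟩
    2 * numEdges G + (d c + 4) + d c
      ≡⟨ collect (2 * numEdges G) (d c) ⟩
    2 * numEdges G + (2 * d c + 4)
      ≡⟨ cong₂ (λ k l → k + (l + 4)) (handshake G) (*-distribˡ-sum 2 (𝟙 ∘ adj c)) ⟩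
    sum d + (sum (λ v → 2 * 𝟙 (adj c v)) + 4)
      ≡⟨ cong (λ k → sum d + (sum (λ v → 2 * 𝟙 (adj c v)) + k)) (sym (sum-*δ 4 c)) ⟩
    sum d + (sum (λ v → 2 * 𝟙 (adj c v)) + sum (λ v → 4 * δ v c))
      ≡⟨ cong (sum d +_) (∑-distrib-+ (λ v → 2 * 𝟙 (adj c v)) _) ⟨
    sum d + sum (λ v → 2 * 𝟙 (adj c v) + 4 * δ v c)
      ≡⟨ ∑-distrib-+ d _ ⟨
    sum (λ v → d v + (2 * 𝟙 (adj c v) + 4 * δ v c))
      ≤⟨ sum-mono local ⟩
    sum (λ v → 4 + d c * δ v c)
      ≡⟨ ∑-distrib-+ {n} (λ _ → 4) (λ v → d c * δ v c) ⟩
    sum {n} (λ _ → 4) + sum (λ v → d c * δ v c)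
      ≡⟨ cong₂ _+_ (sum-const n 4) (sum-*δ (d c) c) ⟩
    n * 4 + d c ∎)
    where
    open ℕ.≤-Reasoning
    collect : ∀ e k → e + (k + 4) + k ≡ e + (2 * k + 4)
    collect = solve-∀
    -- Neighbours of `c` are 2 below the average 4, and `c` exceeds it by `d c - 4`. In total 2e ≤
    -- 4n - d(c) - 4, and d(c) is at least 5.
    local : ∀ v → d v + (2 * 𝟙 (adj c v) + 4 * δ v c) ≤ 4 + d c * δ v c
    local v with v Fin.≟ c
    ... | yes refl rewrite adj-irrefl c | ℕ.*-identityʳ (d c) = ℕ.≤-reflexive (ℕ.+-comm (d c) 4)
    ... | no v≢c rewrite ℕ.*-zeroʳ (d c) | ℕ.+-identityʳ (2 * 𝟙 (adj c v)) with adj c v in cv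
    ...   | true = ℕ.+-monoˡ-≤ 2 (neighbour-of-hub G free 5≤ cv)
    ...   | false = ℕ.+-monoˡ-≤ 0 (others v v≢c)

  -- Hubs are pairwise nonadjacent, so none of them receives anything and each ends with 0. This
  -- leaves room for 4 extra units at `c` and at `c′`. A vertex that does receive has degree at most
  -- 2 and hence gets at most 2.
  two-hub-bound : ∀ {c c′} → 5 ≤ d c → 5 ≤ d c′ → c ≢ c′ → 2 * numEdges G + 8 ≤ n * 4
  two-hub-bound {c} {c′} 5≤ 5≤′ c≢c′ = begin
    2 * numEdges G + 8
      ≡⟨ cong₂ _+_ (handshake G) (sym (cong₂ _+_ (sum-*δ 4 c) (sum-*δ 4 c′))) ⟩
    sum d + (sum (λ v → 4 * δ v c) + sum (λ v → 4 * δ v c′))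
      ≡⟨ cong (sum d +_) (∑-distrib-+ (λ v → 4 * δ v c) _) ⟨
    sum d + sum (λ v → 4 * δ v c + 4 * δ v c′)
      ≡⟨ ∑-distrib-+ d _ ⟨
    sum (λ v → d v + (4 * δ v c + 4 * δ v c′))
      ≤⟨ discharge transfer _ (λ _ → 4) local ⟩
    sum {n} (λ _ → 4)
      ≡⟨ sum-const n 4 ⟩
    n * 4 ∎
    where
    open ℕ.≤-Reasoning
    hub : Fin n → Bool
    hub v = does (5 ℕ.≤? d v)
    transfer : Fin n → Fin n → ℕ
    transfer v u = 𝟙 (hub v ∧ adj v u)
    charges : ∀ v → 4 * δ v c + 4 * δ v c′ ≤ 4
    charges v with v Fin.≟ c | v Fin.≟ c′
    ... | yes refl | yes e = contradiction e c≢c′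
    ... | yes _ | no _ = ℕ.≤-refl
    ... | no _ | yes _ = ℕ.≤-refl
    ... | no _ | no _ = z≤n
    received-zero : ∀ v → 5 ≤ d v → ∀ u → transfer u v ≡ 0
    received-zero v 5≤v u with hub u in hu | adj u v in uv
    ... | false | _ = refl
    ... | true | false = refl
    ... | true | true = contradiction
      (ℕ.≤-trans 5≤v (neighbour-of-hub G free (does-true (5 ℕ.≤? d u) hu) uv)) λ { (s≤s (s≤s ())) }
    local : ∀ v → (d v + (4 * δ v c + 4 * δ v c′)) + sum (λ u → transfer u v) ≤ 4 + sum (transfer v)
    local v with 5 ℕ.≤? d v in hv
    ... | yes 5≤v = begin
      (d v + (4 * δ v c + 4 * δ v c′)) + sum (λ u → transfer u v)
        ≡⟨ cong ((d v + (4 * δ v c + 4 * δ v c′)) +_) (sum-zero (received-zero v 5≤v)) ⟩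
      (d v + (4 * δ v c + 4 * δ v c′)) + 0
        ≡⟨ ℕ.+-identityʳ _ ⟩
      d v + (4 * δ v c + 4 * δ v c′)
        ≤⟨ ℕ.+-monoʳ-≤ (d v) (charges v) ⟩
      d v + 4
        ≡⟨ ℕ.+-comm (d v) 4 ⟩
      4 + d v
        ≡⟨ cong (4 +_) (sum-cong-≗ (λ u → cong (λ b → 𝟙 (b ∧ adj v u)) (sym (cong does hv)))) ⟩
      4 + sum (transfer v) ∎
    ... | no 5≰v = begin
      (d v + (4 * δ v c + 4 * δ v c′)) + sum (λ u → transfer u v)
        ≡⟨ cong (λ k → d v + k + sum (λ u → transfer u v))
             (cong₂ (λ k l → 4 * k + 4 * l) (δ-≢ {i = v} v≢c) (δ-≢ {i = v} v≢c′)) ⟩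
      (d v + 0) + sum (λ u → transfer u v)
        ≡⟨ cong (_+ sum (λ u → transfer u v)) (ℕ.+-identityʳ (d v)) ⟩
      d v + sum (λ u → transfer u v)
        ≤⟨ received (1 ℕ.≤? sum (λ u → transfer u v)) ⟩
      4 ≤⟨ ℕ.m≤m+n 4 _ ⟩
      4 + sum (transfer v) ∎
      where
      v≢c : v ≢ c
      v≢c refl = 5≰v 5≤
      v≢c′ : v ≢ c′
      v≢c′ refl = 5≰v 5≤′
      pointwise : ∀ h {b b′} → b ≡ b′ → 𝟙 (h ∧ b) ≤ 𝟙 b′
      pointwise false refl = z≤n
      pointwise true refl = ℕ.≤-refl
      received : Dec (1 ≤ sum (λ u → transfer u v)) → d v + sum (λ u → transfer u v) ≤ 4
      received (no 1≰) = ℕ.≤-trans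
        (ℕ.≤-reflexive (trans (cong (d v +_) (ℕ.n≤0⇒n≡0 (ℕ.≤-pred (ℕ.≰⇒> 1≰)))) (ℕ.+-identityʳ _)))
        (ℕ.≤-pred (ℕ.≰⇒> 5≰v))
      received (yes 1≤) with count-witness (λ u → hub u ∧ adj u v) 1≤
      ... | u , huv = ℕ.+-mono-≤ d≤2 (ℕ.≤-trans (sum-mono (λ u → pointwise (hub u) (adj-sym u v))) d≤2)
        where
        d≤2 : d v ≤ 2
        d≤2 = neighbour-of-hub G free (does-true (5 ℕ.≤? d u) (∧-trueˡ (hub u) huv)) (∧-trueʳ (hub u) huv)

  private
    from-double : 2 * numEdges G + 8 ≤ n * 4 → numEdges G ≤ 2 * n ∸ 4
    from-double le = ℕ.m+n≤o⇒m≤o∸n (numEdges G) {4} {2 * n} (ℕ.*-cancelˡ-≤ 2 (begin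
      2 * (numEdges G + 4)  ≡⟨ ℕ.*-distribˡ-+ 2 (numEdges G) 4 ⟩
      2 * numEdges G + 8    ≤⟨ le ⟩
      n * 4                 ≡⟨ quadruple n ⟩
      2 * (2 * n)           ∎))
      where
      open ℕ.≤-Reasoning
      quadruple : ∀ n → n * 4 ≡ 2 * (2 * n)
      quadruple = solve-∀

    -- e ≤ 9n/5 gives e ≤ 2n - 4 by integrality as soon as n/5 > 3.
    from-fifths : 16 ≤ n → 5 * (2 * numEdges G) + n * 2 ≤ n * 20 → numEdges G ≤ 2 * n ∸ 4
    from-fifths 16≤n le with numEdges G + 4 ℕ.≤? 2 * n
    ... | yes e+4≤ = ℕ.m+n≤o⇒m≤o∸n (numEdges G) {4} {2 * n} e+4≤
    ... | no e+4≰ = contradiction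
      -- If e + 4 > 2n, the bound in fifths leaves 2n ≤ 30.
      (ℕ.≤-trans (ℕ.*-monoˡ-≤ 2 16≤n) (ℕ.+-cancelˡ-≤ (n * 20 + 10) _ 30 excess))
      (ℕ.<⇒≱ (ℕ.m≤m+n 31 1))
      where
      open ℕ.≤-Reasoning
      factor : ∀ n → n * 20 + 10 + n * 2 ≡ 10 * suc (2 * n) + n * 2
      factor = solve-∀
      expand : ∀ e n → 10 * (e + 4) + n * 2 ≡ 5 * (2 * e) + n * 2 + 40
      expand = solve-∀
      excess : n * 20 + 10 + n * 2 ≤ n * 20 + 10 + 30
      excess = begin
        n * 20 + 10 + n * 2
          ≡⟨ factor n ⟩
        10 * suc (2 * n) + n * 2
          ≤⟨ ℕ.+-monoˡ-≤ (n * 2) (ℕ.*-monoʳ-≤ 10 (ℕ.≰⇒> e+4≰)) ⟩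
        10 * (numEdges G + 4) + n * 2
          ≡⟨ expand (numEdges G) n ⟩
        5 * (2 * numEdges G) + n * 2 + 40
          ≤⟨ ℕ.+-monoˡ-≤ 40 le ⟩
        n * 20 + 40
          ≡⟨ ℕ.+-assoc (n * 20) 10 30 ⟨
        n * 20 + 10 + 30 ∎

  edge-bound : 16 ≤ n → numEdges G ≤ 2 * n ∸ 4
  edge-bound 16≤n with Fin.any? (λ v → 5 ℕ.≤? d v)
  ... | no no-hub = from-fifths 16≤n
    (SmallDegrees.small-degrees-bound (λ v → ℕ.≤-pred (ℕ.≰⇒> (λ 5≤ → no-hub (v , 5≤)))))
  ... | yes (c , 5≤) with Fin.any? (λ v → ¬? (v Fin.≟ c) ×-dec (5 ℕ.≤? d v))
  ...   | yes (c′ , c′≢c , 5≤′) = from-double (two-hub-bound 5≤′ 5≤ c′≢c)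
  ...   | no no-other = from-double (one-hub-bound 5≤
    (λ v v≢c → ℕ.≤-pred (ℕ.≰⇒> (λ 5≤′ → no-other (v , v≢c , 5≤′)))))

-- The extremal graph

isApex : ∀ {m} → Fin (2 + m) → Bool
isApex 0F = true
isApex 1F = true
isApex (suc (suc _)) = false

K₂ₘ : ∀ m → Graph (Fin (2 + m))
K₂ₘ m = record
  { adj    = λ u v → isApex u xor isApex v
  ; sym    = λ u v → Bool.xor-comm (isApex u) (isApex v)
  ; irrefl = λ v → Bool.xor-same (isApex v)
  }

numEdges-K₂ₘ : ∀ m → numEdges (K₂ₘ m) ≡ 2 * (2 + m) ∸ 4
numEdges-K₂ₘ m = ℕ.*-cancelˡ-≡ _ _ 2 (begin
  2 * numEdges (K₂ₘ m)
    ≡⟨ handshake (K₂ₘ m) ⟩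
  -- The degree sum evaluates to this form: m at either apex and 2 at each other vertex.
  sum {m} (λ _ → 1) + (sum {m} (λ _ → 1) + sum {m} (λ _ → 2 + sum {m} (λ _ → 0)))
    ≡⟨ cong₂ (λ k l → k + (k + l)) (sum-const m 1)
         (trans (sum-const m _) (cong (λ k → m * (2 + k)) (trans (sum-const m 0) (ℕ.*-zeroʳ m)))) ⟩
  m * 1 + (m * 1 + m * 2)
    ≡⟨ simplify m ⟩
  2 * (2 * m)
    ≡⟨ cong (2 *_) (ℕ.m+n∸m≡n 4 (2 * m)) ⟨
  2 * (4 + 2 * m ∸ 4)
    ≡⟨ cong (λ k → 2 * (k ∸ 4)) (ℕ.*-distribˡ-+ 2 2 m) ⟨
  2 * (2 * (2 + m) ∸ 4) ∎)
  where
  open ≡-Reasoning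
  simplify : ∀ m → m * 1 + (m * 1 + m * 2) ≡ 2 * (2 * m)
  simplify = solve-∀

two-apices : ∀ {m} (u v w : Fin (2 + m)) → isApex u ≡ true → isApex v ≡ true → isApex w ≡ true →
             u ≡ v ⊎ u ≡ w ⊎ v ≡ w
two-apices 0F 0F _ _ _ _ = inj₁ refl
two-apices 0F 1F 0F _ _ _ = inj₂ (inj₁ refl)
two-apices 0F 1F 1F _ _ _ = inj₂ (inj₂ refl)
two-apices 1F 1F _ _ _ _ = inj₁ refl
two-apices 1F 0F 0F _ _ _ = inj₂ (inj₂ refl)
two-apices 1F 0F 1F _ _ _ = inj₂ (inj₁ refl)

-- The double star is connected and bipartite with two classes of three vertices, `x` with the
-- leaves of `y` and `y` with the leaves of `x`. One class would have to fit into the two apices.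
K₂ₘ-free : ∀ m → Free (doubleStar 2 2) (K₂ₘ m)
K₂ₘ-free m copy = by-side (isApex (embed x)) refl
  where
  open Copy copy
  across : ∀ {b c} → b xor c ≡ true → c ≡ not b
  across {false} e = e
  across {true} {false} e = refl
  too-many : ∀ {s t u} → isApex (embed s) ≡ true → isApex (embed t) ≡ true → isApex (embed u) ≡ true →
             s ≢ t → s ≢ u → t ≢ u → ⊥
  too-many {s} {t} {u} as at au s≢t s≢u t≢u
    with two-apices (embed s) (embed t) (embed u) as at au
  ... | inj₁ e = s≢t (injective e)
  ... | inj₂ (inj₁ e) = s≢u (injective e)
  ... | inj₂ (inj₂ e) = t≢u (injective e)
  other-side : ∀ {s t} b → isApex (embed s) ≡ b → Graph._~_ (doubleStar 2 2) s t → isApex (embed t) ≡ not b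
  other-side b e s~t = trans (across (preserves s~t)) (cong not e)
  by-side : ∀ b → isApex (embed x) ≡ b → ⊥
  by-side true e = too-many {x} {yleaf 0F} {yleaf 1F} e
    (other-side {y} false (other-side {x} {y} true e refl) refl)
    (other-side {y} false (other-side {x} {y} true e refl) refl)
    (λ ()) (λ ()) (λ ())
  by-side false e = too-many {y} {xleaf 0F} {xleaf 1F}
    (other-side {x} false e refl) (other-side {x} false e refl) (other-side {x} false e refl)
    (λ ()) (λ ()) (λ ())

-- A straight-line drawing with the apices at height 1 and -1 and the other vertices on the axis

height : Bool → ℚ
height true = 1ℚ
height false = ℚ.- 1ℚ

natural : ℕ → ℚ
natural k = mkℚ (ℤ.+ k) 0 (Coprimality.sym (1-coprimeTo k))

natural-injective : ∀ {k l} → natural k ≡ natural l → k ≡ l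
natural-injective e = ℤ.+-injective (cong ↥_ e)

spoke : Bool → ℚ → ℚ → Point
spoke b r = onSegment (0ℚ , height b) (r , 0ℚ)

-- The second coordinate is `height b` times 1 - t, and `height b` squares to 1. Thus the height of
-- a point on a spoke determines its parameter.
spoke-parameter : ∀ b t → t ≡ 1ℚ ℚ.- height b ℚ.* lerp (height b) 0ℚ t
spoke-parameter true = solve 1 (λ t →
  t := con 1ℚ :- con 1ℚ :* ((con 1ℚ :- t) :* con 1ℚ :+ t :* con 0ℚ)) refl
spoke-parameter false = solve 1 (λ t →
  t := con 1ℚ :- con (ℚ.- 1ℚ) :* ((con 1ℚ :- t) :* con (ℚ.- 1ℚ) :+ t :* con 0ℚ)) refl

spoke-injective : ∀ b r r′ s t → spoke b r s ≡ spoke b r′ t → s ≡ t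
spoke-injective b _ _ s t e = trans (spoke-parameter b s)
  (trans (cong (λ p → 1ℚ ℚ.- height b ℚ.* proj₂ p) e) (sym (spoke-parameter b t)))

lerp-end : ∀ a b → lerp a b 1ℚ ≡ b
lerp-end a b = trans (sym (lerp-flip a b 1ℚ)) (lerp-start b a)

spoke-start : ∀ b r → spoke b r 0ℚ ≡ (0ℚ , height b)
spoke-start b r = cong₂ _,_ (lerp-start 0ℚ r) (lerp-start (height b) 0ℚ)

spoke-end : ∀ b r → spoke b r 1ℚ ≡ (r , 0ℚ)
spoke-end b r = cong₂ _,_ (lerp-end 0ℚ r) (lerp-end (height b) 0ℚ)

spoke-cancel : ∀ b r r′ {t} → 0ℚ ℚ.< t → spoke b r t ≡ spoke b r′ t → r ≡ r′
spoke-cancel b r r′ {t} 0<t e with ℚ.<-cmp r r′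
... | tri≈ _ r≡r′ _ = r≡r′
... | tri< r<r′ _ _ = contradiction (cong proj₁ e)
  (ℚ.<⇒≢ (ℚ.+-monoʳ-< ((1ℚ ℚ.- t) ℚ.* 0ℚ) (ℚ.*-monoʳ-<-pos t {{ℚ.positive 0<t}} r<r′)))
... | tri> _ _ r′<r = contradiction (sym (cong proj₁ e))
  (ℚ.<⇒≢ (ℚ.+-monoʳ-< ((1ℚ ℚ.- t) ℚ.* 0ℚ) (ℚ.*-monoʳ-<-pos t {{ℚ.positive 0<t}} r′<r)))

-- Spokes from opposite apices lie on opposite sides of the axis. Comparing heights gives s + t = 2,
-- so both parameters are 1.
opposite-spokes : ∀ b r r′ s t → spoke b r s ≡ spoke (not b) r′ t → InUnit s → InUnit t → s ≡ 1ℚ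
opposite-spokes b r r′ s t e (_ , s≤1) (_ , t≤1) = ℚ.≤-antisym s≤1
  (subst₂ ℚ._≤_ refl (sym s≡) (ℚ.+-monoʳ-≤ (1ℚ ℚ.+ 1ℚ) (ℚ.neg-antimono-≤ t≤1)))
  where
  negated : ∀ b → height (not b) ≡ ℚ.- height b
  negated true = refl
  negated false = refl
  h = lerp (height b) 0ℚ s
  s≡ : s ≡ (1ℚ ℚ.+ 1ℚ) ℚ.- t
  s≡ = begin
    s                              ≡⟨ spoke-parameter b s ⟩
    1ℚ ℚ.- height b ℚ.* h
      ≡⟨ solve 2 (λ c h → con 1ℚ :- c :* h :=
           (con 1ℚ :+ con 1ℚ) :- (con 1ℚ :- (:- c) :* h)) refl (height b) h ⟩
    (1ℚ ℚ.+ 1ℚ) ℚ.- (1ℚ ℚ.- (ℚ.- height b) ℚ.* h)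
      ≡⟨ cong₂ (λ c h → (1ℚ ℚ.+ 1ℚ) ℚ.- (1ℚ ℚ.- c ℚ.* h)) (sym (negated b)) (cong proj₂ e) ⟩
    (1ℚ ℚ.+ 1ℚ) ℚ.- (1ℚ ℚ.- height (not b) ℚ.* lerp (height (not b)) 0ℚ t)
      ≡⟨ cong (λ z → (1ℚ ℚ.+ 1ℚ) ℚ.- z) (sym (spoke-parameter (not b) t)) ⟩
    (1ℚ ℚ.+ 1ℚ) ℚ.- t ∎
    where open ≡-Reasoning

segmentArc : ∀ {a b} → (∀ s t → onSegment a b s ≡ onSegment a b t → s ≡ t) → Arc a b
segmentArc {a} {b} injective = record
  { segments = 1
  ; corner   = λ { 0F → a ; 1F → b }
  ; source   = refl
  ; target   = refl
  ; simple   = λ { 0F 0F s t _ _ e → cong (parameter {1} 0F) (injective s t e) }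
  }

module _ {m : ℕ} where

  apex : Bool → Fin (2 + m)
  apex true = 0F
  apex false = 1F

  abscissa : Fin m → ℚ
  abscissa i = natural (toℕ i)

  position : Fin (2 + m) → Point
  position 0F = 0ℚ , height true
  position 1F = 0ℚ , height false
  position (suc (suc i)) = abscissa i , 0ℚ

  position-apex : ∀ b → position (apex b) ≡ (0ℚ , height b)
  position-apex true = refl
  position-apex false = refl

  position-injective : ∀ u v → position u ≡ position v → u ≡ v
  position-injective 0F 0F _ = refl
  position-injective 1F 1F _ = refl
  position-injective (suc (suc i)) (suc (suc j)) e =
    cong (Fin.suc ∘ Fin.suc) (Fin.toℕ-injective (natural-injective (cong proj₁ e)))
  position-injective 0F 1F ()
  position-injective 0F (suc (suc _)) ()
  position-injective 1F 0F ()
  position-injective 1F (suc (suc _)) ()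
  position-injective (suc (suc _)) 0F ()
  position-injective (suc (suc _)) 1F ()

  -- The apices have the two smallest indices, so the smaller end of an edge is always the apex.
  data Spoke : Fin (2 + m) → Fin (2 + m) → Set where
    mkSpoke : ∀ b i → Spoke (apex b) (suc (suc i))

  edge-spoke : ∀ u v → u Fin.< v → isApex u xor isApex v ≡ true → Spoke u v
  edge-spoke 0F (suc (suc i)) _ _ = mkSpoke true i
  edge-spoke 1F (suc (suc i)) _ _ = mkSpoke false i
  edge-spoke (suc (suc _)) 1F (s≤s ()) _

  onSpoke : ∀ b i t {p} → onSegment (position (apex b)) (position (suc (suc i))) t ≡ p →
            spoke b (abscissa i) t ≡ p
  onSpoke b i t = trans (cong (λ a → onSegment a (abscissa i , 0ℚ) t) (sym (position-apex b)))

  -- Every vertex but `apex b` lies on some spoke from the opposite apex, which reduces a vertex on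
  -- a spoke to `opposite-spokes`. For the opposite apex itself the abscissa 0 is an arbitrary
  -- choice.
  vertex-on-spoke : ∀ b w → w ≡ apex b ⊎
    (∃ λ r → ∃ λ s → InUnit s × spoke (not b) r s ≡ position w)
  vertex-on-spoke true 0F = inj₁ refl
  vertex-on-spoke true 1F = inj₂ (0ℚ , 0ℚ , (ℚ.≤-refl , 0≤1) , spoke-start false 0ℚ)
  vertex-on-spoke false 0F = inj₂ (0ℚ , 0ℚ , (ℚ.≤-refl , 0≤1) , spoke-start true 0ℚ)
  vertex-on-spoke false 1F = inj₁ refl
  vertex-on-spoke b (suc (suc i)) =
    inj₂ (abscissa i , 1ℚ , (0≤1 , ℚ.≤-refl) , spoke-end (not b) (abscissa i))

  spoke-simple : ∀ {u v} → Spoke u v → ∀ s t →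
    onSegment (position u) (position v) s ≡ onSegment (position u) (position v) t → s ≡ t
  spoke-simple (mkSpoke b i) s t e =
    spoke-injective b (abscissa i) (abscissa i) s t (trans (onSpoke b i s e) (sym (onSpoke b i t refl)))

  spoke-no-vertex : ∀ {u v} → Spoke u v → ∀ w t → InUnit t →
    onSegment (position u) (position v) t ≡ position w → position w ≢ position u → position w ≡ position v
  spoke-no-vertex (mkSpoke b i) w t ut e w≢u with vertex-on-spoke b w
  ... | inj₁ refl = contradiction refl w≢u
  ... | inj₂ (r , s , us , e′) = trans (sym (onSpoke b i t e)) (trans
    (cong (spoke b (abscissa i)) (opposite-spokes b (abscissa i) r t s (trans (onSpoke b i t e) (sym e′)) ut us))
    (spoke-end b (abscissa i)))

  -- Spokes from opposite apices meet only on the axis, where the first one has its end. On spokes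
  -- from the same apex a common point has equal parameters; these are positive away from the apex,
  -- so the abscissae agree.
  spoke-no-crossing : ∀ {u v u′ v′} → Spoke u v → Spoke u′ v′ → ∀ {p} s t → InUnit s → InUnit t →
    onSegment (position u) (position v) s ≡ p → onSegment (position u′) (position v′) t ≡ p →
    p ≢ position u → p ≢ position v → (u , v) ≡ (u′ , v′)
  spoke-no-crossing (mkSpoke b i) (mkSpoke b′ i′) {p} s t us ut e e′ p≢u p≢v with b′ Bool.≟ b
  ... | no b′≢b = contradiction
    (trans (sym (onSpoke b i s e)) (trans
      (cong (spoke b (abscissa i)) (opposite-spokes b (abscissa i) (abscissa i′) s t
        (subst (λ c → spoke b (abscissa i) s ≡ spoke c (abscissa i′) t) (Bool.¬-not b′≢b) same-point) us ut))
      (spoke-end b (abscissa i)))) p≢v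
    where
    same-point : spoke b (abscissa i) s ≡ spoke b′ (abscissa i′) t
    same-point = trans (onSpoke b i s e) (sym (onSpoke b′ i′ t e′))
  ... | yes refl = cong (λ j → apex b , Fin.suc (Fin.suc j))
    (Fin.toℕ-injective (natural-injective (spoke-cancel b (abscissa i) (abscissa i′) 0<s
      (trans same-point (cong (spoke b (abscissa i′)) (sym (spoke-injective b (abscissa i) (abscissa i′) s t same-point)))))))
    where
    same-point : spoke b (abscissa i) s ≡ spoke b (abscissa i′) t
    same-point = trans (onSpoke b i s e) (sym (onSpoke b i′ t e′))
    0<s : 0ℚ ℚ.< s
    0<s with ℚ.<-cmp 0ℚ s
    ... | tri< u _ _ = u
    ... | tri> _ _ u = contradiction (ℚ.<-≤-trans u (proj₁ us)) (ℚ.<-irrefl refl)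
    ... | tri≈ _ refl _ = contradiction
      (trans (sym (onSpoke b i s e)) (trans (spoke-start b (abscissa i)) (sym (position-apex b)))) p≢u

K₂ₘ-planar : ∀ m → Planar (K₂ₘ m)
K₂ₘ-planar m = record
  { pos          = position
  ; pos-distinct = λ {u} {v} → position-injective u v
  ; arc          = λ e → segmentArc (spoke-simple (spokeOf e))
  ; no-vertex    = λ { e w ((0F , t , ut , at≡) , w≢lo , w≢hi) →
      w≢hi (spoke-no-vertex (spokeOf e) w t ut at≡ w≢lo) }
  ; no-crossing  = λ { e f e≢f p ((0F , s , us , at≡) , p≢lo , p≢hi) (0F , t , ut , at≡′) →
      e≢f (spoke-no-crossing (spokeOf e) (spokeOf f) s t us ut at≡ at≡′ p≢lo p≢hi) }
  }
  where
  spokeOf : (e : Edge (K₂ₘ m)) → Spoke (Edge.lo e) (Edge.hi e)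
  spokeOf e = edge-spoke (Edge.lo e) (Edge.hi e) (Edge.ordered e) (Edge.adjacent e)

theorem1p1 : (n : ℕ) → 16 ≤ n → ex𝒫[ n , doubleStar 2 2 ]≡ (2 * n ∸ 4)
theorem1p1 n@(suc (suc m)) 16≤n = record
  { attained = K₂ₘ m , K₂ₘ-planar m , K₂ₘ-free m , numEdges-K₂ₘ m
  ; bound    = λ G planar free →
      UpperBound.edge-bound G free (K₅-not-plane planar) 16≤n
  }
theorem1p1 (suc zero) (s≤s ())
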